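{- Let $q$ be a prime power and $m$ an integer with $q\geq m+2\geq 5$. Let $n>0$, $l\geq 0$, and let $V$ be an $(n+l)$-dimensional vector space over $\mathbb{F}_q$ with a fixed $l$-dimensional subspace $W_1$. Let $\mathscr{F}\subseteq\mathcal{M}(m,k;n+l,n)$ be an intersecting family with covering number $\tau(\mathscr{F})=m$. Define $$t=\begin{cases}\max\{0,2m-1-n\}, & \text{if } k=0,\\ m+k-1, & \text{if } k\geq 1.\end{cases}$$ Then $|\mathscr{F}|\leq N(m,k;2m-1,t;n+l,n)$, and equality holds if and only if $\mathscr{F}$ is the family of all subspaces of type $(m,k)$ contained in $X$ for some subspace $X$ of $V$ of type $(2m-1,t)$.
   Context: A subspace $P$ of $V$ is of type $(m,k)$ if $\dim P=m$ and $\dim(P\cap W_1)=k$. $\mathcal{M}(m,k;n+l,n)$ denotes the set of all subspaces of $V$ of type $(m,k)$. $N(m_1,k_1;m,k;n+l,n)$ denotes the number of subspaces of type $(m_1,k_1)$ contained in a given subspace of type $(m,k)$ of $V$; it equals $q^{(m_1-k_1)(k-k_1)}{m-k\brack m_1-k_1}_q{k\brack k_1}_q$ when $0\leq k_1\leq k\leq l$ and $0\leq m_1-k_1\leq m-k\leq n$, and $0$ otherwise, where ${a\brack b}_q=\prod_{0\le i<b}\frac{q^{a-i}-1}{q^{b-i}-1}$ is the Gaussian binomial coefficient. Two subspaces intersect if their intersection has dimension at least $1$; a family is intersecting if any two members intersect. The covering number $\tau(\mathscr{F})$ is the minimum dimension of a subspace of $V$ intersecting every member of $\mathscr{F}$.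 -}

module Defs where

open import Level using (0ℓ)
open import Data.Nat as ℕ using (ℕ; zero; suc; _≤ᵇ_; _∸_; _^_)
open import Data.Bool using (Bool; true; false; _∧_; if_then_else_)
open import Data.Fin using (Fin)
open import Data.Vec using (Vec; []; _∷_; zipWith; replicate; lookup; foldr)
open import Data.Vec.Relation.Unary.All using (All)
open import Data.Product using (Σ; ∃; _×_; _,_)
open import Data.List using (List)
open import Data.List.Membership.Propositional using (_∈_)
open import Data.List.Relation.Unary.Any using (Any)
open import Data.List.Relation.Unary.AllPairs using (AllPairs)
open import Relation.Binary.PropositionalEquality using (_≡_)
open import Relation.Nullary using (¬_; Dec)
open import Function.Bundles using (_↔_)
open import Algebra.Structures using (IsCommutativeRing)

-- Finite fields: a field (with propositional equality) with exactly q
-- elements (q is then automatically a prime power).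

record FiniteField (q : ℕ) : Set₁ where
  infixl 6 _+_
  infixl 7 _*_
  field
    Carrier : Set
    _+_ _*_ : Carrier → Carrier → Carrier
    -_      : Carrier → Carrier
    0# 1#   : Carrier
    isCommutativeRing : IsCommutativeRing _≡_ _+_ _*_ -_ 0# 1#
    0≢1     : ¬ (0# ≡ 1#)
    inverse : ∀ x → ¬ (x ≡ 0#) → ∃ λ y → x * y ≡ 1#
    _≟_     : (x y : Carrier) → Dec (x ≡ y)
    enumeration : Fin q ↔ Carrier

module LinAlg {q : ℕ} (𝔽 : FiniteField q) where
  open FiniteField 𝔽

  Vect : ℕ → Set
  Vect N = Vec Carrier N

  zeroV : ∀ {N} → Vect N
  zeroV = replicate _ 0#

  _+V_ : ∀ {N} → Vect N → Vect N → Vect N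
  _+V_ = zipWith _+_

  _·V_ : ∀ {N} → Carrier → Vect N → Vect N
  a ·V v = Data.Vec.map (a *_) v

  lincomb : ∀ {N d} → Vec Carrier d → Vec (Vect N) d → Vect N
  lincomb [] [] = zeroV
  lincomb (c ∷ cs) (v ∷ vs) = (c ·V v) +V lincomb cs vs

  Pred : ℕ → Set
  Pred N = Vect N → Bool

  _∩_ : ∀ {N} → Pred N → Pred N → Pred N
  (P ∩ Q) v = P v ∧ Q v

  _⊆_ : ∀ {N} → Pred N → Pred N → Set
  P ⊆ Q = ∀ v → P v ≡ true → Q v ≡ true

  _≐_ : ∀ {N} → Pred N → Pred N → Set
  P ≐ Q = ∀ v → P v ≡ Q v

  record IsSubspace {N} (S : Pred N) : Set where
    field
      zero-mem : S zeroV ≡ true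
      add-mem  : ∀ u v → S u ≡ true → S v ≡ true → S (u +V v) ≡ true
      smul-mem : ∀ a v → S v ≡ true → S (a ·V v) ≡ true

  HasDim : ∀ {N} → Pred N → ℕ → Set
  HasDim {N} S d =
    Σ (Vec (Vect N) d) λ b →
        All (λ v → S v ≡ true) b
      × (∀ c → lincomb c b ≡ zeroV → ∀ i → lookup c i ≡ 0#)
      × (∀ v → S v ≡ true → ∃ λ c → lincomb c b ≡ v)

  Intersect : ∀ {N} → Pred N → Pred N → Set
  Intersect P Q = ∃ λ d → (1 ℕ.≤ d) × HasDim (P ∩ Q) d

  IsOfType : ∀ {N} → Pred N → ℕ → ℕ → Pred N → Set
  IsOfType W₁ m k P = IsSubspace P × HasDim P m × HasDim (P ∩ W₁) k

  Family : ℕ → Set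
  Family N = List (Pred N)

  Distinct : ∀ {N} → Family N → Set
  Distinct = AllPairs (λ P Q → ¬ (P ≐ Q))

  IsIntersecting : ∀ {N} → Family N → Set
  IsIntersecting 𝓕 = ∀ {P Q} → P ∈ 𝓕 → Q ∈ 𝓕 → Intersect P Q

  Covers : ∀ {N} → Pred N → Family N → Set
  Covers T 𝓕 = ∀ {P} → P ∈ 𝓕 → Intersect T P

  CoveringNumber : ∀ {N} → Family N → ℕ → Set
  CoveringNumber {N} 𝓕 m =
      (Σ (Pred N) λ T → IsSubspace T × HasDim T m × Covers T 𝓕)
    × (∀ (T : Pred N) d → IsSubspace T → HasDim T d → Covers T 𝓕 → m ℕ.≤ d)

-- Gaussian binomial coefficient [a choose b]_q via the q-Pascal rule
gauss : ℕ → ℕ → ℕ → ℕ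
gauss q a zero = 1
gauss q zero (suc b) = 0
gauss q (suc a) (suc b) = gauss q a b ℕ.+ q ^ (suc b) ℕ.* gauss q a (suc b)

Ncount : (q m₁ k₁ m k n l : ℕ) → ℕ
Ncount q m₁ k₁ m k n l =
  if (k₁ ≤ᵇ k) ∧ (k ≤ᵇ l) ∧ (k₁ ≤ᵇ m₁) ∧ (k ≤ᵇ m)
       ∧ ((m₁ ∸ k₁) ≤ᵇ (m ∸ k)) ∧ ((m ∸ k) ≤ᵇ n)
  then q ^ ((m₁ ∸ k₁) ℕ.* (k ∸ k₁)) ℕ.* gauss q (m ∸ k) (m₁ ∸ k₁) ℕ.* gauss q k k₁
  else 0

tParam : (m k n : ℕ) → ℕ
tParam m zero n = (2 ℕ.* m ∸ 1) ∸ n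
tParam m (suc k) n = m ℕ.+ suc k ∸ 1

-- Put p = q − 1 and r = m − 1; dimensions are read off cardinalities, and nonzero vectors
-- replace projective points.  If all members of a subfamily meet S, then counting pairs
-- (member P, nonzero b ∈ S ∩ P) bounds p times its size by |S| times the largest number of
-- its members through one b.  Since no A of dimension a < m meets all of 𝓕, iterating this
-- gives p^(m−a) |𝓕_A| ≤ q^(m(m−a)) for the members 𝓕_A containing A.
--
-- The bound improves when dim A = r.  Choose B ∈ 𝓕 with A ∩ B = 0 and put X = A + B; every
-- member through A lies in X.  If some C ∈ 𝓕 with A ∩ C = 0 is not contained in X, the members
-- through A all meet C ∩ X, of dimension at most r, so p |𝓕_A| ≤ q^r.  If this happens for all
-- such A, then p^m |𝓕| ≤ q^r q^(mr).  Otherwise some A has all members missing it inside X.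
-- Then either 𝓕 lies in X, which has dimension 2m − 1, or some C ∈ 𝓕 does not; in the latter
-- case each member meets C ∩ X or A, so p^m |𝓕| ≤ 2 q^r q^(mr).  As q ≥ m + 2, Bernoulli's
-- inequality gives 2 q^r < p^m, hence |𝓕| < q^(mr), which is at most the claimed bound.
--
-- So let 𝓕 lie in X.  For k ≥ 1 the covering number forces dim (X ∩ W₁) = m + k − 1; for k = 0
-- the q-Pascal rule shows that the count is largest when X ∩ W₁ is as small as possible.  The
-- subspaces of type (m, k) in X are counted through their bases adapted to X ∩ W₁.

module Submission where

open import Defs
open import Level using (0ℓ)
open import Data.Nat hiding (_≟_)
open import Data.Nat.Properties hiding (_≟_)
open import Data.Nat.Solver using (module +-*-Solver)
open import Data.Bool using (Bool; true; false; _∧_; _∨_; not)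
import Data.Bool.Properties as Bool
open import Data.Fin using (Fin; zero; suc)
import Data.Fin.Properties as Fin
open import Data.List using (List; []; _∷_; map; concatMap; _++_; length; tabulate)
open import Data.List.Properties using (length-tabulate)
open import Data.List.Membership.Propositional using (_∈_; find; lose)
open import Data.List.Relation.Unary.Any using (Any; here; there)
open import Data.List.Relation.Unary.All as All using ()
open import Data.List.Relation.Unary.AllPairs using (AllPairs; []; _∷_)
open import Data.Vec as Vec using (Vec; []; _∷_; lookup)
import Data.Vec.Properties as Vec
import Data.Vec.Relation.Unary.All as AllV
open import Data.Product using (Σ; ∃; _×_; _,_; proj₁; proj₂)
open import Data.Sum using (_⊎_; inj₁; inj₂)
open import Data.Empty using (⊥; ⊥-elim)
open import Relation.Nullary using (¬_; Dec; yes; no; does)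
open import Relation.Binary.PropositionalEquality hiding ([_])
open import Relation.Binary.PropositionalEquality.Algebra using (isMagma)
open import Function using (_∘_)
open import Function.Bundles using (_↔_; Inverse; _⇔_; mk⇔; Equivalence)
open import Algebra.Structures using (IsCommutativeRing)
open import Algebra.Bundles using (AbelianGroup)
open +-*-Solver using (solve; con; _:+_; _:*_; _:=_)

-- Counting in finite types

private variable
  α β : Set

⟦_⟧ : Bool → ℕ
⟦ true ⟧ = 1
⟦ false ⟧ = 0

⟦⟧-∧ : ∀ a b → ⟦ a ∧ b ⟧ ≡ ⟦ a ⟧ * ⟦ b ⟧
⟦⟧-∧ true b = sym (+-identityʳ _)
⟦⟧-∧ false b = refl

⟦⟧-mono : ∀ {a b} → (a ≡ true → b ≡ true) → ⟦ a ⟧ ≤ ⟦ b ⟧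
⟦⟧-mono {true} f rewrite f refl = ≤-refl
⟦⟧-mono {false} f = z≤n

iff⇒≡ : ∀ {a b} → (a ≡ true → b ≡ true) → (b ≡ true → a ≡ true) → a ≡ b
iff⇒≡ {true} f g = sym (f refl)
iff⇒≡ {false} {true} f g = g refl
iff⇒≡ {false} {false} f g = refl

∧-intro : ∀ {a b} → a ≡ true → b ≡ true → a ∧ b ≡ true
∧-intro refl refl = refl

∧-elimˡ : ∀ {a b} → a ∧ b ≡ true → a ≡ true
∧-elimˡ {true} e = refl

∧-elimʳ : ∀ {a b} → a ∧ b ≡ true → b ≡ true
∧-elimʳ {true} e = e

not-true⇒false : ∀ {a} → ¬ (a ≡ true) → a ≡ false
not-true⇒false {true} n = ⊥-elim (n refl)
not-true⇒false {false} n = refl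

false⇒not-true : ∀ {a} → a ≡ false → ¬ (a ≡ true)
false⇒not-true refl ()

not-elim : ∀ {a} → not a ≡ true → ¬ (a ≡ true)
not-elim {false} _ ()

not-intro : ∀ {a} → ¬ (a ≡ true) → not a ≡ true
not-intro {true} n = ⊥-elim (n refl)
not-intro {false} n = refl

bool? : ∀ b → (b ≡ true) ⊎ (b ≡ false)
bool? true = inj₁ refl
bool? false = inj₂ refl

does-true : {P : Set} (d : Dec P) → P → does d ≡ true
does-true (yes _) p = refl
does-true (no n) p = ⊥-elim (n p)

does-elim : {P : Set} (d : Dec P) → does d ≡ true → P
does-elim (yes p) _ = p

-- Sums over lists.

∑ : List α → (α → ℕ) → ℕ
∑ [] f = 0
∑ (x ∷ xs) f = f x + ∑ xs f

infix 8 ∑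
syntax ∑ xs (λ x → e) = ∑[ x ∈ xs ] e

∑-cong : ∀ (xs : List α) {f g : α → ℕ} → (∀ {x} → x ∈ xs → f x ≡ g x) → ∑ xs f ≡ ∑ xs g
∑-cong [] e = refl
∑-cong (x ∷ xs) e = cong₂ _+_ (e (here refl)) (∑-cong xs (e ∘ there))

∑-mono : ∀ (xs : List α) {f g : α → ℕ} → (∀ {x} → x ∈ xs → f x ≤ g x) → ∑ xs f ≤ ∑ xs g
∑-mono [] e = z≤n
∑-mono (x ∷ xs) e = +-mono-≤ (e (here refl)) (∑-mono xs (e ∘ there))

∑-zero : ∀ (xs : List α) → ∑[ x ∈ xs ] 0 ≡ 0
∑-zero [] = refl
∑-zero (x ∷ xs) = ∑-zero xs

∑-one : ∀ (xs : List α) → ∑[ x ∈ xs ] 1 ≡ length xs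
∑-one [] = refl
∑-one (x ∷ xs) = cong suc (∑-one xs)

∑-+ : ∀ (xs : List α) (f g : α → ℕ) → ∑[ x ∈ xs ] (f x + g x) ≡ ∑ xs f + ∑ xs g
∑-+ [] f g = refl
∑-+ (x ∷ xs) f g rewrite ∑-+ xs f g =
  solve 4 (λ a b c d → a :+ b :+ (c :+ d) := a :+ c :+ (b :+ d)) refl (f x) (g x) (∑ xs f) (∑ xs g)
 

∑-*ˡ : ∀ (xs : List α) c (f : α → ℕ) → ∑[ x ∈ xs ] (c * f x) ≡ c * ∑ xs f
∑-*ˡ [] c f = sym (*-zeroʳ c)
∑-*ˡ (x ∷ xs) c f rewrite ∑-*ˡ xs c f = sym (*-distribˡ-+ c (f x) _)

∑-*ʳ : ∀ (xs : List α) c (f : α → ℕ) → ∑[ x ∈ xs ] (f x * c) ≡ ∑ xs f * c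
∑-*ʳ [] c f = refl
∑-*ʳ (x ∷ xs) c f rewrite ∑-*ʳ xs c f = sym (*-distribʳ-+ c (f x) _)

∑-swap : ∀ (xs : List α) (ys : List β) (f : α → β → ℕ) →
  ∑[ x ∈ xs ] (∑[ y ∈ ys ] (f x y)) ≡ ∑[ y ∈ ys ] (∑[ x ∈ xs ] (f x y))
∑-swap [] ys f = sym (∑-zero ys)
∑-swap (x ∷ xs) ys f rewrite ∑-swap xs ys f = sym (∑-+ ys (f x) _)

∑-map : ∀ (h : α → β) xs (f : β → ℕ) → ∑ (map h xs) f ≡ ∑ xs (f ∘ h)
∑-map h [] f = refl
∑-map h (x ∷ xs) f = cong (f (h x) +_) (∑-map h xs f)

∑-++ : ∀ (xs ys : List α) (f : α → ℕ) → ∑ (xs ++ ys) f ≡ ∑ xs f + ∑ ys f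
∑-++ [] ys f = refl
∑-++ (x ∷ xs) ys f rewrite ∑-++ xs ys f = sym (+-assoc (f x) _ _)

∑-concatMap : ∀ (h : α → List β) xs (f : β → ℕ) → ∑ (concatMap h xs) f ≡ ∑[ x ∈ xs ] (∑ (h x) f)
∑-concatMap h [] f = refl
∑-concatMap h (x ∷ xs) f =
  trans (∑-++ (h x) (concatMap h xs) f) (cong (∑ (h x) f +_) (∑-concatMap h xs f))

∑-term : ∀ {xs : List α} {x} (f : α → ℕ) → x ∈ xs → f x ≤ ∑ xs f
∑-term f (here refl) = m≤m+n _ _
∑-term f (there i) = ≤-trans (∑-term f i) (m≤n+m _ _)

∑-positive : ∀ (xs : List α) (f : α → ℕ) → 1 ≤ ∑ xs f → ∃ λ x → (x ∈ xs) × 1 ≤ f x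
∑-positive (x ∷ xs) f h with 1 ≤? f x
... | yes p = x , here refl , p
... | no n with ∑-positive xs f (subst (1 ≤_) (cong (_+ ∑ xs f) (n<1⇒n≡0 (≰⇒> n))) h)
... | y , i , p = y , there i , p

-- No term of `f` can exceed its partner, so a loss at one term could not be recovered at another.
-- This drives `⊆-card` and the equality case of the final count.
∑-tight : ∀ (xs : List α) {f g : α → ℕ} → (∀ {x} → x ∈ xs → f x ≤ g x) → ∑ xs g ≤ ∑ xs f →
  ∀ {x} → x ∈ xs → f x ≡ g x
∑-tight (x ∷ xs) {f} {g} le h i = go i
  where
  le' = ∑-mono xs (le ∘ there)
  head≡ : f x ≡ g x
  head≡ = ≤-antisym (le (here refl))
    (+-cancelʳ-≤ (∑ xs f) _ _ (≤-trans (+-monoʳ-≤ (g x) le') h))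
  tail≤ : ∑ xs g ≤ ∑ xs f
  tail≤ = +-cancelˡ-≤ (f x) _ _ (subst (λ z → z + ∑ xs g ≤ f x + ∑ xs f) (sym head≡) h)
  go : ∀ {y} → y ∈ x ∷ xs → f y ≡ g y
  go (here refl) = head≡
  go (there j) = ∑-tight xs (le ∘ there) tail≤ j

-- Distinctness is taken up to an arbitrary relation because members of a family are Boolean
-- predicates, told apart only up to `≐`.
∑-at-most-one : ∀ {_≈_ : α → α → Set} (xs : List α) (p : α → Bool) →
  AllPairs (λ x y → ¬ (x ≈ y)) xs →
  (∀ {x y} → x ∈ xs → y ∈ xs → p x ≡ true → p y ≡ true → x ≈ y) → ∑[ x ∈ xs ] ⟦ p x ⟧ ≤ 1
∑-at-most-one [] p d u = z≤n
∑-at-most-one {_≈_ = _≈_} (x ∷ xs) p (dx ∷ d) u with p x in eq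
... | false = ∑-at-most-one xs p d (λ i j → u (there i) (there j))
... | true = ≤-reflexive (cong suc (trans (∑-cong xs none) (∑-zero xs)))
  where
  none : ∀ {y} → y ∈ xs → ⟦ p y ⟧ ≡ 0
  none {y} i with p y in eq'
  ... | false = refl
  ... | true = ⊥-elim (All.lookup dx i (u (here refl) (there i) eq eq'))

-- A finite conjunction with an escape: `E` is whatever a single failing element supplies. In
-- `chain` it passes an exceptional configuration up through the recursion.
allOr : ∀ {E : Set} {P : α → Set} xs → (∀ {x} → x ∈ xs → E ⊎ P x) → E ⊎ (∀ {x} → x ∈ xs → P x)
allOr [] h = inj₂ λ ()
allOr (x ∷ xs) h with h (here refl) | allOr xs (h ∘ there)
... | inj₁ e | _ = inj₁ e
... | inj₂ _ | inj₁ e = inj₁ e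
... | inj₂ p | inj₂ ps = inj₂ λ { (here refl) → p ; (there i) → ps i }

search∈ : ∀ (xs : List α) (p : α → Bool) →
  (∃ λ x → (x ∈ xs) × p x ≡ true) ⊎ (∀ {x} → x ∈ xs → p x ≡ false)
search∈ xs p = allOr xs λ {x} i → case x i (bool? (p x))
  where
  case : ∀ x → x ∈ xs → (p x ≡ true) ⊎ (p x ≡ false) → (∃ λ x → (x ∈ xs) × p x ≡ true) ⊎ (p x ≡ false)
  case x i (inj₁ t) = inj₁ (x , i , t)
  case x i (inj₂ f) = inj₂ f

-- The field `once` says in one equation that nothing is missing and nothing is repeated, in the
-- form that sums of indicators use.
record Finite (α : Set) : Set where
  field
    elems : List α
    _≟_   : (x y : α) → Dec (x ≡ y)
    once  : ∀ a → ∑[ x ∈ elems ] ⟦ does (x ≟ a) ⟧ ≡ 1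

  complete : ∀ a → a ∈ elems
  complete a with ∑-positive elems _ (≤-reflexive (sym (once a)))
  ... | x , i , h with x ≟ a
  ... | yes refl = i

  ∑-unique : ∀ (p : α → Bool) a → p a ≡ true → (∀ x → p x ≡ true → x ≡ a) → ∑[ x ∈ elems ] ⟦ p x ⟧ ≡ 1
  ∑-unique p a pa u = trans (∑-cong elems λ {x} _ → cong ⟦_⟧
    (iff⇒≡ (λ t → does-true (x ≟ a) (u x t)) (λ t → trans (cong p (does-elim (x ≟ a) t)) pa))) (once a)

  ∑-at : ∀ a (f : α → ℕ) → ∑[ x ∈ elems ] (⟦ does (x ≟ a) ⟧ * f x) ≡ f a
  ∑-at a f = trans (trans (∑-cong elems eq) (∑-*ʳ elems (f a) _)) (trans (cong (_* f a) (once a)) (+-identityʳ _))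
    where
    eq : ∀ {x} → x ∈ elems → ⟦ does (x ≟ a) ⟧ * f x ≡ ⟦ does (x ≟ a) ⟧ * f a
    eq {x} _ with x ≟ a
    ... | yes refl = refl
    ... | no _ = refl

  -- Each `f (g x)` is a sum of `f y` against a point mass. After the sums are exchanged, `f y` is
  -- weighted by the number of preimages of `y`, which is one.
  ∑-reindex : ∀ (g h : α → α) → (∀ x → g (h x) ≡ x) → (∀ x → h (g x) ≡ x) →
    ∀ (f : α → ℕ) → ∑[ x ∈ elems ] (f (g x)) ≡ ∑ elems f
  ∑-reindex g h gh hg f = begin
    ∑[ x ∈ elems ] (f (g x))
      ≡⟨ ∑-cong elems (λ {x} _ → sym (∑-at (g x) f)) ⟩
    ∑[ x ∈ elems ] (∑[ y ∈ elems ] (⟦ does (y ≟ g x) ⟧ * f y))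
      ≡⟨ ∑-swap elems elems _ ⟩
    ∑[ y ∈ elems ] (∑[ x ∈ elems ] (⟦ does (y ≟ g x) ⟧ * f y))
      ≡⟨ ∑-cong elems (λ {y} _ → trans (∑-*ʳ elems (f y) _) (trans (cong (_* f y) (pre y)) (+-identityʳ _))) ⟩
    ∑ elems f ∎
    where
    open ≡-Reasoning
    pre : ∀ y → ∑[ x ∈ elems ] ⟦ does (y ≟ g x) ⟧ ≡ 1
    pre y = ∑-unique (λ x → does (y ≟ g x)) (h y) (does-true (y ≟ g (h y)) (sym (gh y)))
      λ x t → trans (sym (hg x)) (cong h (sym (does-elim (y ≟ g x) t)))

  search : ∀ (p : α → Bool) → (∃ λ x → p x ≡ true) ⊎ (∀ x → p x ≡ false)
  search p with search∈ elems p
  ... | inj₁ (x , _ , t) = inj₁ (x , t)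
  ... | inj₂ f = inj₂ λ x → f (complete x)

  exists : (α → Bool) → Bool
  exists p with search p
  ... | inj₁ _ = true
  ... | inj₂ _ = false

  exists-intro : ∀ p x → p x ≡ true → exists p ≡ true
  exists-intro p x t with search p
  ... | inj₁ _ = refl
  ... | inj₂ f = ⊥-elim (false⇒not-true (f x) t)

  exists-elim : ∀ p → exists p ≡ true → ∃ λ x → p x ≡ true
  exists-elim p e with search p
  ... | inj₁ w = w

  forAll : (α → Bool) → Bool
  forAll p = not (exists (not ∘ p))

  forAll-elim : ∀ p → forAll p ≡ true → ∀ x → p x ≡ true
  forAll-elim p e x with p x in eq
  ... | true = refl
  ... | false = ⊥-elim (not-elim e (exists-intro (not ∘ p) x (cong not eq)))

  forAll-intro : ∀ p → (∀ x → p x ≡ true) → forAll p ≡ true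
  forAll-intro p h = not-intro λ e → let (x , t) = exists-elim (not ∘ p) e in not-elim t (h x)

finite-↔ : ∀ {n} → (∀ (x y : α) → Dec (x ≡ y)) → Fin n ↔ α → Finite α
finite-↔ {n = n} dec iso = record
  { elems = tabulate to
  ; _≟_ = dec
  ; once = λ a → trans (once-Fin to (λ {i j} e → trans (sym (strictlyInverseʳ i)) (trans (cong from e) (strictlyInverseʳ j))) (from a) a (strictlyInverseˡ a)) refl
  }
  where
  open Inverse iso
  module _ where
    avoid : ∀ {n} (f : Fin n → _) a → (∀ i → ¬ (f i ≡ a)) → ∑[ x ∈ tabulate f ] ⟦ does (dec x a) ⟧ ≡ 0
    avoid {zero} f a h = refl
    avoid {suc n} f a h with dec (f zero) a
    ... | yes e = ⊥-elim (h zero e)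
    ... | no _ = avoid (f ∘ suc) a (h ∘ suc)
    once-Fin : ∀ {n} (f : Fin n → _) → (∀ {i j} → f i ≡ f j → i ≡ j) → ∀ i a → f i ≡ a →
      ∑[ x ∈ tabulate f ] ⟦ does (dec x a) ⟧ ≡ 1
    once-Fin f inj zero a e with dec (f zero) a
    ... | yes _ = cong suc (avoid (f ∘ suc) a λ i e' → Fin.0≢1+n (inj (trans e (sym e'))))
    ... | no n = ⊥-elim (n e)
    once-Fin f inj (suc i) a e with dec (f zero) a
    ... | yes e' = ⊥-elim (Fin.0≢1+n (inj (trans e' (sym e))))
    ... | no n = once-Fin (f ∘ suc) (Fin.suc-injective ∘ inj) i a e

module _ (𝔸 : Finite α) where
  open Finite 𝔸

  elemsVec : ∀ n → List (Vec α n)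
  elemsVec zero = [] ∷ []
  elemsVec (suc n) = concatMap (λ x → map (x ∷_) (elemsVec n)) (elems)

  ∑-elemsVec : ∀ n (f : Vec α (suc n) → ℕ) →
    ∑ (elemsVec (suc n)) f ≡ ∑[ x ∈ elems ] (∑[ xs ∈ elemsVec n ] (f (x ∷ xs)))
  ∑-elemsVec n f = trans (∑-concatMap _ (elems) f)
    (∑-cong (elems) λ {x} _ → ∑-map (x ∷_) (elemsVec n) f)

  finiteVec : ∀ n → Finite (Vec α n)
  finiteVec n = record { elems = elemsVec n ; _≟_ = Vec.≡-dec (_≟_) ; once = go }
    where
    go : ∀ {n} (v : Vec α n) → ∑[ x ∈ elemsVec n ] ⟦ does (Vec.≡-dec (_≟_) x v) ⟧ ≡ 1
    go [] = refl
    go {suc n} (y ∷ ys) = begin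
      _ ≡⟨ ∑-elemsVec n _ ⟩
      _ ≡⟨ ∑-cong (elems) (λ {x} _ → ∑-cong (elemsVec n) λ {xs} _ →
             ⟦⟧-∧ (does (x ≟ y)) (does (Vec.≡-dec (_≟_) xs ys))) ⟩
      _ ≡⟨ ∑-cong (elems) (λ {x} _ → trans (∑-*ˡ (elemsVec n) ⟦ does (x ≟ y) ⟧ _) (cong (⟦ does (x ≟ y) ⟧ *_) (go ys))) ⟩
      _ ≡⟨ ∑-cong (elems) (λ _ → *-identityʳ _) ⟩
      _ ≡⟨ once y ⟩
      1 ∎
      where open ≡-Reasoning

  length-elemsVec : ∀ n → length (elemsVec n) ≡ length (elems) ^ n
  length-elemsVec n = trans (sym (∑-one (elemsVec n))) (go n)
    where
    go : ∀ n → ∑[ x ∈ elemsVec n ] 1 ≡ length (elems) ^ n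
    go zero = refl
    go (suc n) = trans (∑-elemsVec n _) (trans (∑-cong (elems) (λ _ → trans (go n) (sym (*-identityˡ _))))
      (trans (∑-*ʳ (elems) _ (λ _ → 1)) (cong (_* length (elems) ^ n) (∑-one (elems)))))

-- Vector spaces over a finite field

module VectorSpace {q : ℕ} (𝔽 : FiniteField q) where
  open FiniteField 𝔽 renaming (_+_ to _⊞_; _*_ to _⊡_; -_ to ⊟_) public
  open LinAlg 𝔽 public
  module R = IsCommutativeRing isCommutativeRing

  finiteCarrier : Finite Carrier
  finiteCarrier = finite-↔ _≟_ enumeration

  finiteVect : ∀ N → Finite (Vect N)
  finiteVect = finiteVec finiteCarrier

  vects : ∀ N → List (Vect N)
  vects N = Finite.elems (finiteVect N)

  length-vects : ∀ N → length (vects N) ≡ q ^ N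
  length-vects N = trans (length-elemsVec finiteCarrier N) (cong (_^ N) (length-tabulate {n = q} _))

  1<q : 1 < q
  1<q = go enumeration
    where
    same : (i j : Fin 1) → i ≡ j
    same zero zero = refl
    -- The size is generalised so that the values 0 and 1 can be refuted by cases: the field
    -- contains `0#` and a different element `1#`.
    go : ∀ {n} → Fin n ↔ Carrier → 1 < n
    go {0} e with Inverse.from e 0#
    ... | ()
    go {1} e = ⊥-elim (0≢1 (trans (sym (Inverse.strictlyInverseˡ e 0#))
      (trans (cong (Inverse.to e) (same _ _)) (Inverse.strictlyInverseˡ e 1#))))
    go {suc (suc _)} e = s≤s (s≤s z≤n)

  instance
    q≢0 : NonZero q
    q≢0 = >-nonZero (<-trans z<s 1<q)

  private variable
    N : ℕ

  negV : Vect N → Vect N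
  negV v = (⊟ 1#) ·V v

  _-V_ : Vect N → Vect N → Vect N
  u -V v = u +V (negV v)

  infixl 6 _-V_

  +V-identityˡ : (v : Vect N) → zeroV +V v ≡ v
  +V-identityˡ [] = refl
  +V-identityˡ (x ∷ v) = cong₂ _∷_ (R.+-identityˡ x) (+V-identityˡ v)

  +V-identityʳ : (v : Vect N) → v +V zeroV ≡ v
  +V-identityʳ v = trans (Vec.zipWith-comm R.+-comm v zeroV) (+V-identityˡ v)

  ·V-distribˡ : ∀ a (u v : Vect N) → a ·V (u +V v) ≡ (a ·V u) +V (a ·V v)
  ·V-distribˡ a [] [] = refl
  ·V-distribˡ a (x ∷ u) (y ∷ v) = cong₂ _∷_ (R.distribˡ a x y) (·V-distribˡ a u v)

  ·V-distribʳ : ∀ a b (v : Vect N) → (a ⊞ b) ·V v ≡ (a ·V v) +V (b ·V v)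
  ·V-distribʳ a b [] = refl
  ·V-distribʳ a b (x ∷ v) = cong₂ _∷_ (R.distribʳ x a b) (·V-distribʳ a b v)

  ·V-assoc : ∀ a b (v : Vect N) → (a ⊡ b) ·V v ≡ a ·V (b ·V v)
  ·V-assoc a b [] = refl
  ·V-assoc a b (x ∷ v) = cong₂ _∷_ (R.*-assoc a b x) (·V-assoc a b v)

  ·V-identity : (v : Vect N) → 1# ·V v ≡ v
  ·V-identity [] = refl
  ·V-identity (x ∷ v) = cong₂ _∷_ (R.*-identityˡ x) (·V-identity v)

  ·V-zeroˡ : (v : Vect N) → 0# ·V v ≡ zeroV
  ·V-zeroˡ [] = refl
  ·V-zeroˡ (x ∷ v) = cong₂ _∷_ (R.zeroˡ x) (·V-zeroˡ v)

  ·V-zeroʳ : ∀ a → a ·V zeroV {N} ≡ zeroV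
  ·V-zeroʳ {zero} a = refl
  ·V-zeroʳ {suc N} a = cong₂ _∷_ (R.zeroʳ a) (·V-zeroʳ a)

  +V-inverseˡ : (v : Vect N) → (negV v) +V v ≡ zeroV
  +V-inverseˡ v = begin
    (negV v) +V v           ≡⟨ cong ((negV v) +V_) (sym (·V-identity v)) ⟩
    (negV v) +V (1# ·V v)   ≡⟨ sym (·V-distribʳ (⊟ 1#) 1# v) ⟩
    (⊟ 1# ⊞ 1#) ·V v      ≡⟨ cong (_·V v) (R.-‿inverseˡ 1#) ⟩
    0# ·V v               ≡⟨ ·V-zeroˡ v ⟩
    zeroV ∎
    where open ≡-Reasoning

  vectGroup : ℕ → AbelianGroup 0ℓ 0ℓ
  vectGroup N = record
    { Carrier = Vect N ; _≈_ = _≡_ ; _∙_ = _+V_ ; ε = zeroV ; _⁻¹ = negV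
    ; isAbelianGroup = record
      { isGroup = record
        { isMonoid = record
          { isSemigroup = record
            { isMagma = isMagma _+V_
            ; assoc = Vec.zipWith-assoc R.+-assoc }
          ; identity = +V-identityˡ , +V-identityʳ }
        ; inverse = +V-inverseˡ , λ v → trans (Vec.zipWith-comm R.+-comm v _) (+V-inverseˡ v)
        ; ⁻¹-cong = cong negV }
      ; comm = Vec.zipWith-comm R.+-comm } }

  module G {N : ℕ} where
    open AbelianGroup (vectGroup N) public using (assoc; comm; inverseˡ; inverseʳ)

  scale-cancel : ∀ {c} → ¬ (c ≡ 0#) → ∃ λ d → ∀ (v : Vect N) → d ·V (c ·V v) ≡ v
  scale-cancel {c = c} c≢0 with inverse c c≢0
  ... | d , cd = d , λ v → trans (sym (·V-assoc d c v))
    (trans (cong (_·V v) (trans (R.*-comm d c) cd)) (·V-identity v))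

  [u-v]+v : (u v : Vect N) → (u -V v) +V v ≡ u
  [u-v]+v u v = trans (G.assoc u (negV v) v) (trans (cong (u +V_) (+V-inverseˡ v)) (+V-identityʳ u))

  [u+v]-v : (u v : Vect N) → (u +V v) -V v ≡ u
  [u+v]-v u v = trans (G.assoc u v (negV v)) (trans (cong (u +V_) (G.inverseʳ v)) (+V-identityʳ u))

  [u+v]-u : (u v : Vect N) → (u +V v) -V u ≡ v
  [u+v]-u u v = trans (cong (_-V u) (G.comm u v)) ([u+v]-v v u)

  u-[u-v] : (u v : Vect N) → u -V (u -V v) ≡ v
  u-[u-v] u v = trans (cong (_-V (u -V v)) (sym ([u-v]+v u v))) ([u+v]-u (u -V v) v)

  u-[v+w] : (u v w : Vect N) → u -V (v +V w) ≡ (u -V w) -V v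
  u-[v+w] u v w = begin
    u +V (negV (v +V w))          ≡⟨ cong (u +V_) (trans (·V-distribˡ _ v w) (G.comm (negV v) (negV w))) ⟩
    u +V ((negV w) +V (negV v))     ≡⟨ sym (G.assoc u (negV w) (negV v)) ⟩
    (u -V w) -V v ∎
    where open ≡-Reasoning

  card : Pred N → ℕ
  card {N} S = ∑[ v ∈ vects N ] ⟦ S v ⟧

  ⊆-refl : {S : Pred N} → S ⊆ S
  ⊆-refl v h = h

  ⊆-trans : {S T U : Pred N} → S ⊆ T → T ⊆ U → S ⊆ U
  ⊆-trans f g v h = g v (f v h)

  ⊆-antisym : {S T : Pred N} → S ⊆ T → T ⊆ S → S ≐ T
  ⊆-antisym f g v = iff⇒≡ (f v) (g v)

  ≐⇒⊆ : {S T : Pred N} → S ≐ T → S ⊆ T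
  ≐⇒⊆ e v h = trans (sym (e v)) h

  ≐-sym : {S T : Pred N} → S ≐ T → T ≐ S
  ≐-sym e v = sym (e v)

  ∩⊆ˡ : (S T : Pred N) → (S ∩ T) ⊆ S
  ∩⊆ˡ S T v = ∧-elimˡ

  ∩⊆ʳ : (S T : Pred N) → (S ∩ T) ⊆ T
  ∩⊆ʳ S T v = ∧-elimʳ

  card-mono : {S T : Pred N} → S ⊆ T → card S ≤ card T
  card-mono {N} f = ∑-mono (vects N) λ {v} _ → ⟦⟧-mono (f v)

  card-cong : {S T : Pred N} → S ≐ T → card S ≡ card T
  card-cong {N} e = ∑-cong (vects N) λ {v} _ → cong ⟦_⟧ (e v)

  ⊆-card : {S T : Pred N} → S ⊆ T → card T ≤ card S → T ⊆ S
  ⊆-card {N} {S} {T} f h v t = go (∑-tight (vects N) (λ {v} _ → ⟦⟧-mono (f v)) h (Finite.complete (finiteVect N) v))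
    where
    go : ⟦ S v ⟧ ≡ ⟦ T v ⟧ → S v ≡ true
    go e with S v
    ... | true = refl
    ... | false rewrite t = ⊥-elim (0≢1+n e)

  card-universe : card {N} (λ _ → true) ≡ q ^ N
  card-universe {N} = trans (∑-one (vects N)) (length-vects N)

  opaque
    -- Inclusion as a Boolean, so that the members above a given subspace can be counted by sums of
    -- indicators.
    sub? : Pred N → Pred N → Bool
    sub? {N} S T = Finite.forAll (finiteVect N) (λ v → not (S v) ∨ T v)

    sub?-elim : (S T : Pred N) → sub? S T ≡ true → S ⊆ T
    sub?-elim {N} S T h v s with S v | T v | Finite.forAll-elim (finiteVect N) _ h v
    ... | true | true | _ = refl

    sub?-intro : (S T : Pred N) → S ⊆ T → sub? S T ≡ true
    sub?-intro {N} S T f = Finite.forAll-intro (finiteVect N) _ λ v → go v (bool? (S v))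
      where
      go : ∀ v → (S v ≡ true) ⊎ (S v ≡ false) → not (S v) ∨ T v ≡ true
      go v (inj₁ s) rewrite s = f v s
      go v (inj₂ s) rewrite s = refl

  ⊈⇒∃ : (S T : Pred N) → ¬ (S ⊆ T) → ∃ λ v → S v ≡ true × ¬ (T v ≡ true)
  ⊈⇒∃ {N} S T h with Finite.search (finiteVect N) (λ v → S v ∧ not (T v))
  ... | inj₁ (v , e) = v , ∧-elimˡ e , not-elim (∧-elimʳ {S v} e)
  ... | inj₂ f = ⊥-elim (h λ v s → go v s)
    where
    go : S ⊆ T
    go v s with T v in t
    ... | true = refl
    ... | false = ⊥-elim (false⇒not-true (f v) (∧-intro s (not-intro (false⇒not-true t))))

  -- Subspaces and their sums.

  module Sub {S : Pred N} (sub : IsSubspace S) where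
    open IsSubspace sub public

    neg-mem : ∀ {v} → S v ≡ true → S (negV v) ≡ true
    neg-mem = smul-mem _ _

    sub-mem : ∀ {u v} → S u ≡ true → S v ≡ true → S (u -V v) ≡ true
    sub-mem s t = add-mem _ _ s (neg-mem t)

  open Sub public using (zero-mem; add-mem; smul-mem; sub-mem)

  shift-mem : {S : Pred N} → IsSubspace S → ∀ u {v} → S v ≡ true → S (u +V v) ≡ S u
  shift-mem {S = S} sub u {v} s = iff⇒≡
    (λ t → trans (cong S (sym ([u+v]-v u v))) (sub-mem sub t s))
    (λ t → add-mem sub u v t s)

  universe : IsSubspace {N} (λ _ → true)
  universe = record { zero-mem = refl ; add-mem = λ _ _ _ _ → refl ; smul-mem = λ _ _ _ → refl }

  ∩-subspace : {S T : Pred N} → IsSubspace S → IsSubspace T → IsSubspace (S ∩ T)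
  ∩-subspace {S = S} {T} s t = record
    { zero-mem = ∧-intro (zero-mem s) (zero-mem t)
    ; add-mem = λ u v a b → ∧-intro (add-mem s u v (∧-elimˡ a) (∧-elimˡ b))
                                     (add-mem t u v (∧-elimʳ {S u} a) (∧-elimʳ {S v} b))
    ; smul-mem = λ c v a → ∧-intro (smul-mem s c v (∧-elimˡ a)) (smul-mem t c v (∧-elimʳ {S v} a)) }

  subspace-cong : {S T : Pred N} → S ≐ T → IsSubspace S → IsSubspace T
  subspace-cong e s = record
    { zero-mem = trans (sym (e _)) (zero-mem s)
    ; add-mem = λ u v a b → trans (sym (e _)) (add-mem s u v (trans (e _) a) (trans (e _) b))
    ; smul-mem = λ c v a → trans (sym (e _)) (smul-mem s c v (trans (e _) a)) }

  infixl 21 _⊹_ _⊕_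

  opaque
    _⊹_ : Pred N → Pred N → Pred N
    _⊹_ {N} S T v = Finite.exists (finiteVect N) (λ a → S a ∧ T (v -V a))

    ⊹-intro : (S T : Pred N) → ∀ {a b} → S a ≡ true → T b ≡ true → (S ⊹ T) (a +V b) ≡ true
    ⊹-intro S T {a} {b} s t = Finite.exists-intro (finiteVect _) _ a
      (∧-intro s (trans (cong T ([u+v]-u a b)) t))

    ⊹-elim : (S T : Pred N) → ∀ {v} → (S ⊹ T) v ≡ true →
      ∃ λ a → ∃ λ b → S a ≡ true × T b ≡ true × v ≡ a +V b
    ⊹-elim S T {v} h with Finite.exists-elim (finiteVect _) _ h
    ... | a , e = a , v -V a , ∧-elimˡ e , ∧-elimʳ {S a} e , sym (trans (G.comm a _) ([u-v]+v v a))

  interchange : (a b c d : Vect N) → (a +V b) +V (c +V d) ≡ (a +V c) +V (b +V d)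
  interchange a b c d = begin
    (a +V b) +V (c +V d) ≡⟨ G.assoc a b _ ⟩
    a +V (b +V (c +V d)) ≡⟨ cong (a +V_) (sym (G.assoc b c d)) ⟩
    a +V ((b +V c) +V d) ≡⟨ cong (λ z → a +V (z +V d)) (G.comm b c) ⟩
    a +V ((c +V b) +V d) ≡⟨ cong (a +V_) (G.assoc c b d) ⟩
    a +V (c +V (b +V d)) ≡⟨ sym (G.assoc a c _) ⟩
    (a +V c) +V (b +V d) ∎
    where open ≡-Reasoning

  module _ {S T : Pred N} (s : IsSubspace S) (t : IsSubspace T) where
    ⊹-subspace : IsSubspace (S ⊹ T)
    ⊹-subspace = record
      { zero-mem = trans (cong (S ⊹ T) (sym (+V-identityˡ zeroV))) (⊹-intro S T (zero-mem s) (zero-mem t))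
      ; add-mem = add
      ; smul-mem = smul }
      where
      add : ∀ u v → (S ⊹ T) u ≡ true → (S ⊹ T) v ≡ true → (S ⊹ T) (u +V v) ≡ true
      add u v hu hv with ⊹-elim S T hu | ⊹-elim S T hv
      ... | a , b , sa , tb , refl | a' , b' , sa' , tb' , refl =
        trans (cong (S ⊹ T) (interchange a b a' b')) (⊹-intro S T (add-mem s a a' sa sa') (add-mem t b b' tb tb'))
      smul : ∀ c v → (S ⊹ T) v ≡ true → (S ⊹ T) (c ·V v) ≡ true
      smul c v hv with ⊹-elim S T hv
      ... | a , b , sa , tb , refl =
        trans (cong (S ⊹ T) (·V-distribˡ c a b)) (⊹-intro S T (smul-mem s c a sa) (smul-mem t c b tb))

    ⊆⊹ˡ : S ⊆ (S ⊹ T)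
    ⊆⊹ˡ v h = trans (cong (S ⊹ T) (sym (+V-identityʳ v))) (⊹-intro S T h (zero-mem t))

    ⊆⊹ʳ : T ⊆ (S ⊹ T)
    ⊆⊹ʳ v h = trans (cong (S ⊹ T) (sym (+V-identityˡ v))) (⊹-intro S T (zero-mem s) h)

    ⊹-least : {U : Pred N} → IsSubspace U → S ⊆ U → T ⊆ U → (S ⊹ T) ⊆ U
    ⊹-least u f g v h with ⊹-elim S T h
    ... | a , b , sa , tb , refl = add-mem u a b (f a sa) (g b tb)

    opaque
      unfolding _⊹_

      -- Every vector of S + T has exactly |S ∩ T| decompositions.
      card-⊹ : card (S ⊹ T) * card (S ∩ T) ≡ card S * card T
      card-⊹ = begin
        card (S ⊹ T) * card (S ∩ T)
          ≡⟨ sym (∑-*ʳ (vects N) (card (S ∩ T)) _) ⟩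
        ∑[ v ∈ vects N ] (⟦ (S ⊹ T) v ⟧ * card (S ∩ T))
          ≡⟨ ∑-cong (vects N) (λ {v} _ → sym (fibre v (bool? ((S ⊹ T) v)))) ⟩
        ∑[ v ∈ vects N ] (∑[ a ∈ vects N ] ⟦ S a ∧ T (v -V a) ⟧)
          ≡⟨ ∑-swap (vects N) (vects N) _ ⟩
        ∑[ a ∈ vects N ] (∑[ v ∈ vects N ] ⟦ S a ∧ T (v -V a) ⟧)
          ≡⟨ ∑-cong (vects N) (λ {a} _ → ∑-cong (vects N) λ {v} _ → ⟦⟧-∧ (S a) (T (v -V a))) ⟩
        ∑[ a ∈ vects N ] (∑[ v ∈ vects N ] (⟦ S a ⟧ * ⟦ T (v -V a) ⟧))
          ≡⟨ ∑-cong (vects N) (λ {a} _ → trans (∑-*ˡ (vects N) ⟦ S a ⟧ _) (cong (⟦ S a ⟧ *_)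
               (Finite.∑-reindex (finiteVect N) (_-V a) (_+V a) (λ x → [u+v]-v x a) (λ x → [u-v]+v x a) (⟦_⟧ ∘ T)))) ⟩
        ∑[ a ∈ vects N ] (⟦ S a ⟧ * card T)
          ≡⟨ ∑-*ʳ (vects N) (card T) _ ⟩
        card S * card T ∎
        where
        open ≡-Reasoning
        fibre : ∀ v → ((S ⊹ T) v ≡ true) ⊎ ((S ⊹ T) v ≡ false) →
          ∑[ a ∈ vects N ] ⟦ S a ∧ T (v -V a) ⟧ ≡ ⟦ (S ⊹ T) v ⟧ * card (S ∩ T)
        fibre v (inj₂ e) rewrite e = trans (∑-cong (vects N) λ {a} _ → cong ⟦_⟧ (not-true⇒false λ h →
          false⇒not-true e (Finite.exists-intro (finiteVect N) _ a h))) (∑-zero (vects N))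
        fibre v (inj₁ e) with ⊹-elim S T e
        -- One decomposition `a₀ +V b₀` is fixed. The others differ from it by vectors of `S ∩ T`,
        -- so translating the index by `a₀` leaves the indicator of that intersection.
        ... | a₀ , b₀ , sa , tb , refl rewrite e = begin
          ∑[ a ∈ vects N ] ⟦ S a ∧ T ((a₀ +V b₀) -V a) ⟧
            ≡⟨ sym (Finite.∑-reindex (finiteVect N) (_+V a₀) (_-V a₀) (λ x → [u-v]+v x a₀) (λ x → [u+v]-v x a₀)
                 (λ a → ⟦ S a ∧ T ((a₀ +V b₀) -V a) ⟧)) ⟩
          ∑[ a ∈ vects N ] ⟦ S (a +V a₀) ∧ T ((a₀ +V b₀) -V (a +V a₀)) ⟧
            ≡⟨ ∑-cong (vects N) (λ {a} _ → cong ⟦_⟧ (cong₂ _∧_ (shift-mem s a sa) (eq a))) ⟩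
          card (S ∩ T)
            ≡⟨ sym (+-identityʳ _) ⟩
          1 * card (S ∩ T) ∎
          where
          eq : ∀ a → T ((a₀ +V b₀) -V (a +V a₀)) ≡ T a
          eq a = trans (cong T (trans (u-[v+w] (a₀ +V b₀) a a₀) (cong (_-V a) ([u+v]-u a₀ b₀))))
            (iff⇒≡ (λ h → trans (cong T (sym (u-[u-v] b₀ a))) (sub-mem t tb h)) (λ h → sub-mem t tb h))

  -- Lines and extensions by one vector.

  opaque
    line : Vect N → Pred N
    line x v = Finite.exists finiteCarrier (λ c → does (Finite._≟_ (finiteVect _) (c ·V x) v))

    line-intro : (x : Vect N) → ∀ c → line x (c ·V x) ≡ true
    line-intro x c = Finite.exists-intro finiteCarrier _ c (does-true (Finite._≟_ (finiteVect _) (c ·V x) (c ·V x)) refl)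

    line-elim : (x : Vect N) → ∀ {v} → line x v ≡ true → ∃ λ c → c ·V x ≡ v
    line-elim x h with Finite.exists-elim finiteCarrier _ h
    ... | c , e = c , does-elim (Finite._≟_ (finiteVect _) (c ·V x) _) e

  line-subspace : (x : Vect N) → IsSubspace (line x)
  line-subspace x = record
    { zero-mem = trans (cong (line x) (sym (·V-zeroˡ x))) (line-intro x 0#)
    ; add-mem = add ; smul-mem = smul }
    where
    add : ∀ u v → line x u ≡ true → line x v ≡ true → line x (u +V v) ≡ true
    add u v hu hv with line-elim x hu | line-elim x hv
    ... | c , refl | d , refl = trans (cong (line x) (sym (·V-distribʳ c d x))) (line-intro x _)
    smul : ∀ a v → line x v ≡ true → line x (a ·V v) ≡ true
    smul a v hv with line-elim x hv
    ... | c , refl = trans (cong (line x) (sym (·V-assoc a c x))) (line-intro x _)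

  line-least : {S : Pred N} → IsSubspace S → ∀ {x} → S x ≡ true → line x ⊆ S
  line-least s {x} sx v h with line-elim x h
  ... | c , refl = smul-mem s c x sx

  self∈line : (x : Vect N) → line x x ≡ true
  self∈line x = trans (cong (line x) (sym (·V-identity x))) (line-intro x 1#)

  _⊕_ : Pred N → Vect N → Pred N
  S ⊕ x = S ⊹ line x

  module _ {S : Pred N} (s : IsSubspace S) (x : Vect N) where
    ⊕-subspace : IsSubspace (S ⊕ x)
    ⊕-subspace = ⊹-subspace s (line-subspace x)

    ⊆⊕ : S ⊆ (S ⊕ x)
    ⊆⊕ = ⊆⊹ˡ s (line-subspace x)

    ∈⊕ : (S ⊕ x) x ≡ true
    ∈⊕ = ⊆⊹ʳ s (line-subspace x) x (self∈line x)

    ⊕-least : {U : Pred N} → IsSubspace U → S ⊆ U → U x ≡ true → (S ⊕ x) ⊆ U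
    ⊕-least u f ux = ⊹-least s (line-subspace x) u f (line-least u ux)

  ⊕-elim : {S : Pred N} → ∀ {x v} → (S ⊕ x) v ≡ true → ∃ λ a → ∃ λ c → S a ≡ true × v ≡ a +V (c ·V x)
  ⊕-elim {S = S} {x} h with ⊹-elim S (line x) h
  ... | a , b , sa , lb , e with line-elim x lb
  ...   | c , refl = a , c , sa , e

  opaque
    zeroS : Pred N
    zeroS {N} v = does (Finite._≟_ (finiteVect N) v zeroV)

    zeroS-elim : (v : Vect N) → zeroS v ≡ true → v ≡ zeroV
    zeroS-elim {N} v = does-elim (Finite._≟_ (finiteVect N) v zeroV)

    zeroS-intro : (v : Vect N) → v ≡ zeroV → zeroS v ≡ true
    zeroS-intro {N} v = does-true (Finite._≟_ (finiteVect N) v zeroV)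

  zeroS-subspace : IsSubspace (zeroS {N})
  zeroS-subspace {N} = record
    { zero-mem = zeroS-intro (zeroV {N}) refl
    ; add-mem = λ u v a b → zeroS-intro (u +V v) (trans (cong₂ _+V_ (zeroS-elim u a) (zeroS-elim v b)) (+V-identityˡ zeroV))
    ; smul-mem = λ c v a → zeroS-intro (c ·V v) (trans (cong (c ·V_) (zeroS-elim v a)) (·V-zeroʳ c)) }

  zeroS⊆ : {S : Pred N} → IsSubspace S → zeroS ⊆ S
  zeroS⊆ {S = S} s v h = trans (cong S (zeroS-elim v h)) (zero-mem s)

  opaque
    unfolding zeroS

    card-zeroS : card (zeroS {N}) ≡ 1
    card-zeroS {N} = Finite.once (finiteVect N) zeroV

-- Dimension and cardinality

module Dimension {q : ℕ} (𝔽 : FiniteField q) where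
  open VectorSpace 𝔽

  private variable
    N : ℕ

  ^-cancel-≤ : ∀ {a b} → q ^ a ≤ q ^ b → a ≤ b
  ^-cancel-≤ {a} {b} h with a ≤? b
  ... | yes p = p
  ... | no n = ⊥-elim (<⇒≱ (^-monoʳ-< q 1<q (≰⇒> n)) h)

  ^-injective : ∀ {a b} → q ^ a ≡ q ^ b → a ≡ b
  ^-injective e = ≤-antisym (^-cancel-≤ (≤-reflexive e)) (^-cancel-≤ (≤-reflexive (sym e)))

  lincomb-mem : {S : Pred N} → IsSubspace S → ∀ {d} (c : Vec Carrier d) (b : Vec (Vect N) d) →
    AllV.All (λ v → S v ≡ true) b → S (lincomb c b) ≡ true
  lincomb-mem s [] [] AllV.[] = zero-mem s
  lincomb-mem s (c ∷ cs) (v ∷ b) (h AllV.∷ hs) = add-mem s _ _ (smul-mem s c v h) (lincomb-mem s cs b hs)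

  lincomb-+ : ∀ {d} (c e : Vec Carrier d) (b : Vec (Vect N) d) → lincomb (c +V e) b ≡ lincomb c b +V lincomb e b
  lincomb-+ [] [] [] = sym (+V-identityˡ zeroV)
  lincomb-+ (x ∷ c) (y ∷ e) (v ∷ b) =
    trans (cong₂ _+V_ (·V-distribʳ x y v) (lincomb-+ c e b)) (interchange (x ·V v) (y ·V v) _ _)

  lincomb-· : ∀ {d} a (c : Vec Carrier d) (b : Vec (Vect N) d) → lincomb (a ·V c) b ≡ a ·V lincomb c b
  lincomb-· a [] [] = sym (·V-zeroʳ a)
  lincomb-· a (x ∷ c) (v ∷ b) =
    trans (cong₂ _+V_ (·V-assoc a x v) (lincomb-· a c b)) (sym (·V-distribˡ a (x ·V v) _))

  lookup-zero : ∀ {d} (c : Vect d) → (∀ i → lookup c i ≡ 0#) → c ≡ zeroV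
  lookup-zero [] h = refl
  lookup-zero (x ∷ c) h = cong₂ _∷_ (h zero) (lookup-zero c (h ∘ suc))

  -- Pairs of a coefficient vector and its value are counted in both orders: every coefficient
  -- vector has one value, and spanning and independence give each vector of `S` exactly one
  -- coefficient vector.
  card-HasDim : {S : Pred N} → IsSubspace S → ∀ {d} → HasDim S d → card S ≡ q ^ d
  card-HasDim {N} {S} s {d} (b , mem , indep , span) = begin
    card S ≡⟨ ∑-cong (vects N) (λ {v} _ → sym (fibre v (bool? (S v)))) ⟩
    ∑[ v ∈ vects N ] (∑[ c ∈ vects d ] ⟦ is c v ⟧) ≡⟨ ∑-swap (vects N) (vects d) _ ⟩
    ∑[ c ∈ vects d ] (∑[ v ∈ vects N ] ⟦ is c v ⟧)
      ≡⟨ ∑-cong (vects d) (λ {c} _ → Finite.∑-unique (finiteVect N) (is c) (lincomb c b)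
           (does-true (dec (lincomb c b) (lincomb c b)) refl) λ v h → sym (does-elim (dec (lincomb c b) v) h)) ⟩
    ∑[ c ∈ vects d ] 1 ≡⟨ ∑-one (vects d) ⟩
    length (vects d) ≡⟨ length-vects d ⟩
    q ^ d ∎
    where
    open ≡-Reasoning
    dec = Finite._≟_ (finiteVect N)
    is : Vect d → Vect N → Bool
    is c v = does (dec (lincomb c b) v)
    injective : ∀ c e → lincomb c b ≡ lincomb e b → c ≡ e
    injective c e h = trans (sym ([u-v]+v c e)) (trans (cong (_+V e) (lookup-zero (c -V e) (indep (c -V e) zero-comb))) (+V-identityˡ e))
      where
      zero-comb : lincomb (c -V e) b ≡ zeroV
      zero-comb = trans (lincomb-+ c (negV e) b) (trans (cong (lincomb c b +V_) (lincomb-· _ e b))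
        (trans (cong (_-V lincomb e b) h) (G.inverseʳ (lincomb e b))))
    fibre : ∀ v → (S v ≡ true) ⊎ (S v ≡ false) → ∑[ c ∈ vects d ] ⟦ is c v ⟧ ≡ ⟦ S v ⟧
    fibre v (inj₁ t) rewrite t with span v t
    ... | c , e = Finite.∑-unique (finiteVect d) (λ c → is c v) c (does-true (dec (lincomb c b) v) e)
      λ x h → injective x c (trans (does-elim (dec (lincomb x b) v) h) (sym e))
    fibre v (inj₂ f) rewrite f = trans (∑-cong (vects d) λ {c} _ → cong ⟦_⟧ (not-true⇒false λ h →
      false⇒not-true f (trans (cong S (sym (does-elim (dec (lincomb c b) v) h))) (lincomb-mem s c b mem)))) (∑-zero (vects d))

  private
    pad : Vect N → Vect (suc N)
    pad v = 0# ∷ v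

    lincomb-pad : ∀ {d} (c : Vec Carrier d) (b : Vec (Vect N) d) → lincomb c (Vec.map pad b) ≡ pad (lincomb c b)
    lincomb-pad [] [] = refl
    lincomb-pad (x ∷ c) (v ∷ b) = trans (cong ((x ·V pad v) +V_) (lincomb-pad c b))
      (cong (_∷ ((x ·V v) +V lincomb c b)) (trans (cong (_⊞ 0#) (R.zeroʳ x)) (R.+-identityˡ 0#)))

    all-pad : {S : Pred (suc N)} → ∀ {d} {b : Vec (Vect N) d} →
      AllV.All (λ v → S (pad v) ≡ true) b → AllV.All (λ v → S v ≡ true) (Vec.map pad b)
    all-pad AllV.[] = AllV.[]
    all-pad (h AllV.∷ hs) = h AllV.∷ all-pad hs

  -- Gaussian elimination on the first coordinate.
  basis : {S : Pred N} → IsSubspace S → ∃ λ d → HasDim S d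
  basis {zero} s = 0 , [] , AllV.[] , (λ { [] _ () }) , λ { [] _ → [] , refl }
  basis {suc N} {S} s with basis {N} {λ v → S (pad v)} (record
    { zero-mem = zero-mem s
    ; add-mem = λ u v a b → trans (cong (λ z → S (z ∷ u +V v)) (sym (R.+-identityˡ 0#))) (add-mem s _ _ a b)
    ; smul-mem = λ c v a → trans (cong (λ z → S (z ∷ c ·V v)) (sym (R.zeroʳ c))) (smul-mem s c _ a) })
  -- The recursive basis spans the vectors of `S` with first coordinate zero. A vector with first
  -- coordinate one serves as pivot; if there is none, scaling shows that all first coordinates in
  -- `S` vanish.
  ... | d , b , mem , indep , span with Finite.search (finiteVect N) (λ w → S (1# ∷ w))
  ... | inj₁ (w , sw) = suc d , (1# ∷ w) ∷ Vec.map pad b , sw AllV.∷ all-pad mem , indep' , span'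
    where
    expand : ∀ x c → lincomb (x ∷ c) ((1# ∷ w) ∷ Vec.map pad b) ≡ x ∷ ((x ·V w) +V lincomb c b)
    expand x c = trans (cong ((x ·V (1# ∷ w)) +V_) (lincomb-pad c b))
      (cong (_∷ ((x ·V w) +V lincomb c b)) (trans (R.+-identityʳ _) (R.*-identityʳ x)))
    indep' : ∀ c → lincomb c ((1# ∷ w) ∷ Vec.map pad b) ≡ zeroV → ∀ i → lookup c i ≡ 0#
    indep' (x ∷ c) h = λ { zero → x≡0 ; (suc i) → indep c tail≡0 i }
      where
      h' = trans (sym (expand x c)) h
      x≡0 : x ≡ 0#
      x≡0 = Vec.∷-injectiveˡ h'
      tail≡0 : lincomb c b ≡ zeroV
      tail≡0 = trans (sym (trans (cong (_+V lincomb c b) (trans (cong (_·V w) x≡0) (·V-zeroˡ w))) (+V-identityˡ _)))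
        (Vec.∷-injectiveʳ h')
    span' : ∀ v → S v ≡ true → ∃ λ c → lincomb c ((1# ∷ w) ∷ Vec.map pad b) ≡ v
    span' (x ∷ u) sv with span (u -V (x ·V w)) (trans (cong S (cong₂ _∷_ (sym head≡0) (cong (u +V_) refl)))
                              (sub-mem s sv (smul-mem s x _ sw)))
      where
      head≡0 : x ⊞ (⊟ 1#) ⊡ (x ⊡ 1#) ≡ 0#
      head≡0 = trans (cong (λ z → x ⊞ (⊟ 1#) ⊡ z) (R.*-identityʳ x))
        (Vec.∷-injectiveˡ (G.inverseʳ (x ∷ [])))
    ... | c , e = x ∷ c , trans (expand x c) (cong (x ∷_) (trans (cong ((x ·V w) +V_) e)
      (trans (G.comm (x ·V w) _) ([u-v]+v u (x ·V w)))))
  ... | inj₂ none = d , Vec.map pad b , all-pad mem ,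
    (λ c h → indep c (Vec.∷-injectiveʳ (trans (sym (lincomb-pad c b)) h))) , span'
    where
    span' : ∀ v → S v ≡ true → ∃ λ c → lincomb c (Vec.map pad b) ≡ v
    span' (x ∷ u) sv with x ≟ 0#
    ... | yes refl with span u sv
    ...   | c , e = c , trans (lincomb-pad c b) (cong pad e)
    span' (x ∷ u) sv | no x≢0 with inverse x x≢0
    ... | y , xy = ⊥-elim (false⇒not-true (none (y ·V u))
      (trans (cong (λ z → S (z ∷ y ·V u)) (sym (trans (R.*-comm y x) xy))) (smul-mem s y _ sv)))

  HasDim-card : {S : Pred N} → IsSubspace S → ∀ {d} → card S ≡ q ^ d → HasDim S d
  HasDim-card {S = S} s e with basis s
  ... | d , h = subst (HasDim S) (^-injective (trans (sym (card-HasDim s h)) e)) h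

  card-power : {S : Pred N} → IsSubspace S → ∃ λ d → card S ≡ q ^ d
  card-power s with basis s
  ... | d , h = d , card-HasDim s h

  scalar≡0 : {S : Pred N} → IsSubspace S → ∀ {x} → ¬ (S x ≡ true) → ∀ c → S (c ·V x) ≡ true → c ≡ 0#
  scalar≡0 {S = S} s {x} x∉ c h with c ≟ 0#
  ... | yes e = e
  ... | no n with scale-cancel n
  ...   | d , cancel = ⊥-elim (x∉ (trans (cong S (sym (cancel x))) (smul-mem s d _ h)))

  card-line : {x : Vect N} → ¬ (x ≡ zeroV) → card (line x) ≡ q
  card-line {x = x} x≢0 = trans (card-HasDim (line-subspace x) {1}
    (x ∷ [] , self∈line x AllV.∷ AllV.[] , indep , span)) (*-identityʳ q)
    where
    indep : ∀ c → lincomb c (x ∷ []) ≡ zeroV → ∀ i → lookup c i ≡ 0#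
    indep (c ∷ []) h zero = scalar≡0 {S = zeroS} zeroS-subspace {x} (λ z → x≢0 (zeroS-elim x z)) c
      (zeroS-intro (c ·V x) (trans (sym (+V-identityʳ _)) h))
    span : ∀ v → line x v ≡ true → ∃ λ c → lincomb c (x ∷ []) ≡ v
    span v h with line-elim x h
    ... | c , e = c ∷ [] , trans (+V-identityʳ _) e

  card-⊕ : {S : Pred N} → IsSubspace S → ∀ {x} → ¬ (S x ≡ true) → card (S ⊕ x) ≡ q * card S
  card-⊕ {N} {S} s {x} x∉ = begin
    card (S ⊕ x)                        ≡⟨ sym (*-identityʳ _) ⟩
    card (S ⊕ x) * 1                    ≡⟨ cong (card (S ⊕ x) *_) (sym trivial) ⟩
    card (S ⊕ x) * card (S ∩ line x)    ≡⟨ card-⊹ s (line-subspace x) ⟩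
    card S * card (line x)              ≡⟨ cong (card S *_) (card-line x≢0) ⟩
    card S * q                          ≡⟨ *-comm (card S) q ⟩
    q * card S ∎
    where
    open ≡-Reasoning
    x≢0 : ¬ (x ≡ zeroV)
    x≢0 refl = x∉ (zero-mem s)
    meet : (S ∩ line x) ⊆ zeroS
    meet v h with line-elim x (∧-elimʳ {S v} h)
    ... | c , refl = zeroS-intro (c ·V x) (trans (cong (_·V x) (scalar≡0 s x∉ c (∧-elimˡ h))) (·V-zeroˡ x))
    trivial : card (S ∩ line x) ≡ 1
    trivial = trans (card-cong (⊆-antisym meet (zeroS⊆ (∩-subspace s (line-subspace x))))) (card-zeroS {N})

  ⊕-mono : {S T : Pred N} → IsSubspace S → IsSubspace T → ∀ x → S ⊆ T → (S ⊕ x) ⊆ (T ⊕ x)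
  ⊕-mono s t x f = ⊕-least s x (⊕-subspace t x) (λ v h → ⊆⊕ t x v (f v h)) (∈⊕ t x)

  -- Modular law: when a vector of `S` plus a multiple of `x` lies in `Y`, removing the multiple
  -- stays in `Y`. It lets `count-independent` follow only the trace of `R` on `Y`.
  ⊕-modular : {Y S : Pred N} → IsSubspace Y → IsSubspace S → ∀ {x} → Y x ≡ true →
    (Y ∩ (S ⊕ x)) ≐ ((Y ∩ S) ⊕ x)
  ⊕-modular {Y = Y} {S} y s {x} yx = ⊆-antisym to from
    where
    ys = ∩-subspace y s
    to : (Y ∩ (S ⊕ x)) ⊆ ((Y ∩ S) ⊕ x)
    to v h with ⊕-elim {S = S} {x} (∧-elimʳ {Y v} h)
    ... | a , c , sa , refl = ⊹-intro (Y ∩ S) (line x) (∧-intro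
      (trans (cong Y (sym ([u+v]-v a (c ·V x)))) (sub-mem y (∧-elimˡ h) (smul-mem y c x yx))) sa) (line-intro x c)
    from : ((Y ∩ S) ⊕ x) ⊆ (Y ∩ (S ⊕ x))
    from = ⊕-least ys x (∩-subspace y (⊕-subspace s x))
      (λ v h → ∧-intro (∧-elimˡ h) (⊆⊕ s x v (∧-elimʳ {Y v} h))) (∧-intro yx (∈⊕ s x))

  -- Modulo `S`, a vector of the sum is a multiple of `x`. If the vector lies in `U`, so does that
  -- multiple, and its coefficient must vanish.
  ⊕-∩-outside : {S U : Pred N} → IsSubspace S → IsSubspace U → S ⊆ U → ∀ {x} → ¬ (U x ≡ true) →
    ((S ⊕ x) ∩ U) ≐ S
  ⊕-∩-outside {S = S} {U} s u f {x} x∉ = ⊆-antisym to (λ v h → ∧-intro (⊆⊕ s x v h) (f v h))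
    where
    to : ((S ⊕ x) ∩ U) ⊆ S
    to v h with ⊕-elim {S = S} {x} (∧-elimˡ h)
    ... | a , c , sa , refl = trans (cong S (trans (cong (a +V_) (trans (cong (_·V x) c≡0) (·V-zeroˡ x))) (+V-identityʳ a))) sa
      where
      c≡0 : c ≡ 0#
      c≡0 = scalar≡0 u x∉ c (trans (cong U (sym ([u+v]-u a (c ·V x)))) (sub-mem u (∧-elimʳ {(S ⊕ x) (a +V (c ·V x))} h) (f a sa)))

  nontrivial : {S : Pred N} → q ≤ card S → ∃ λ v → S v ≡ true × ¬ (v ≡ zeroV)
  nontrivial {N} {S} h with ⊈⇒∃ S zeroS (λ f → <⇒≱ 1<q (≤-trans h (≤-trans (card-mono f) (≤-reflexive (card-zeroS {N})))))
  ... | v , sv , n = v , sv , λ e → n (zeroS-intro v e)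

  card≥q : {S : Pred N} → IsSubspace S → ∀ {v} → S v ≡ true → ¬ (v ≡ zeroV) → q ≤ card S
  card≥q s {v} sv n = ≤-trans (≤-reflexive (sym (card-line n))) (card-mono (line-least s sv))

  -- A positive dimension means at least `q` vectors; this inequality is the form in which
  -- intersection is counted.
  Intersect⇒ : {S T : Pred N} → IsSubspace S → IsSubspace T → Intersect S T → q ≤ card (S ∩ T)
  Intersect⇒ s t (suc d , _ , h) = ≤-trans (m≤m*n q (q ^ d) {{m^n≢0 q d}})
    (≤-reflexive (sym (card-HasDim (∩-subspace s t) h)))

  ⇒Intersect : {S T : Pred N} → IsSubspace S → IsSubspace T → ∀ {v} → S v ≡ true → T v ≡ true → ¬ (v ≡ zeroV) →
    Intersect S T
  ⇒Intersect {S = S} {T} s t {v} sv tv n with basis (∩-subspace s t)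
  ... | suc d , h = suc d , s≤s z≤n , h
  ... | zero , h = ⊥-elim (<⇒≱ 1<q (≤-trans (card≥q (∩-subspace s t) (∧-intro sv tv) n) (≤-reflexive (card-HasDim (∩-subspace s t) h))))

  -- Since `S ⊹ T` fits into `Y`, the product formula `card-⊹` becomes an inequality between
  -- exponents.
  dim-∩ : {S T Y : Pred N} → IsSubspace S → IsSubspace T → IsSubspace Y → S ⊆ Y → T ⊆ Y →
    ∀ {a b c d} → card S ≡ q ^ a → card T ≡ q ^ b → card Y ≡ q ^ c → card (S ∩ T) ≡ q ^ d → a + b ≤ c + d
  dim-∩ {S = S} {T} {Y} s t y f g {a} {b} {c} {d} ea eb ec ed = ^-cancel-≤ (begin
    q ^ (a + b)                  ≡⟨ ^-distribˡ-+-* q a b ⟩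
    q ^ a * q ^ b                ≡⟨ sym (cong₂ _*_ ea eb) ⟩
    card S * card T              ≡⟨ sym (card-⊹ s t) ⟩
    card (S ⊹ T) * card (S ∩ T)  ≤⟨ *-monoˡ-≤ _ (card-mono (⊹-least s t y f g)) ⟩
    card Y * card (S ∩ T)        ≡⟨ cong₂ _*_ ec ed ⟩
    q ^ c * q ^ d                ≡⟨ sym (^-distribˡ-+-* q c d) ⟩
    q ^ (c + d) ∎)
    where open ≤-Reasoning

  meet-large : {S T Y : Pred N} → IsSubspace S → IsSubspace T → IsSubspace Y → S ⊆ Y → T ⊆ Y →
    ∀ {a b c} → card S ≡ q ^ a → card T ≡ q ^ b → card Y ≡ q ^ c → c < a + b → Intersect S T
  meet-large {S = S} {T} s t y f g {a} {b} {c} ea eb ec c<ab with basis (∩-subspace s t)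
  ... | suc d , h = suc d , s≤s z≤n , h
  ... | zero , h = ⊥-elim (<⇒≱ c<ab (≤-trans (dim-∩ s t y f g {a} {b} {c} {0} ea eb ec (card-HasDim (∩-subspace s t) h)) (≤-reflexive (+-identityʳ c))))

  card-direct : {S T : Pred N} → IsSubspace S → IsSubspace T → (S ∩ T) ⊆ zeroS →
    ∀ {a b} → card S ≡ q ^ a → card T ≡ q ^ b → card (S ⊹ T) ≡ q ^ (a + b)
  card-direct {N} {S} {T} s t h {a} {b} ea eb = begin
    card (S ⊹ T)                 ≡⟨ sym (*-identityʳ _) ⟩
    card (S ⊹ T) * 1             ≡⟨ cong (card (S ⊹ T) *_) (sym (trans (card-cong (⊆-antisym h (zeroS⊆ (∩-subspace s t)))) (card-zeroS {N}))) ⟩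
    card (S ⊹ T) * card (S ∩ T)  ≡⟨ card-⊹ s t ⟩
    card S * card T              ≡⟨ cong₂ _*_ ea eb ⟩
    q ^ a * q ^ b                ≡⟨ sym (^-distribˡ-+-* q a b) ⟩
    q ^ (a + b) ∎
    where open ≡-Reasoning

  -- Adjoining the extra vector to `S` multiplies its size by `q` and stays inside `T`.
  proper-card : {S T : Pred N} → IsSubspace S → IsSubspace T → S ⊆ T → ∀ {x} → T x ≡ true → ¬ (S x ≡ true) →
    q * card S ≤ card T
  proper-card s t f {x} tx x∉ = ≤-trans (≤-reflexive (sym (card-⊕ s x∉))) (card-mono (⊕-least s x t f tx))

  subspace-of-dim : {S : Pred N} → IsSubspace S → ∀ {d} → card S ≡ q ^ d → ∀ {e} → e ≤ d →
    ∃ λ T → IsSubspace T × T ⊆ S × card T ≡ q ^ e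
  subspace-of-dim {N} {S} s h {zero} _ = zeroS , zeroS-subspace , zeroS⊆ s , card-zeroS {N}
  subspace-of-dim {N} {S} s h {suc e} e<d with subspace-of-dim s h (<⇒≤ e<d)
  ... | T , t , f , ct with ⊈⇒∃ S T (λ g → <⇒≱ (^-monoʳ-< q 1<q e<d)
                              (≤-trans (≤-reflexive (sym h)) (≤-trans (card-mono g) (≤-reflexive ct))))
  ...   | x , sx , x∉ = T ⊕ x , ⊕-subspace t x , ⊕-least t x s f sx , trans (card-⊕ t x∉) (cong (q *_) ct)

-- Families that cannot be covered below dimension m

module Dichotomy {q : ℕ} (𝔽 : FiniteField q) {N : ℕ} (n : ℕ) where
  open VectorSpace 𝔽
  open Dimension 𝔽

  -- Here `n` is m - 2, unlike the `n` of the theorem; `r` and `m` are then successors by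
  -- definition.
  p r m : ℕ
  p = q ∸ 1
  r = suc n
  m = suc r

  nonzero : Vect N → Bool
  nonzero v = not (zeroS v)

  nonzero-elim : ∀ {v} → nonzero v ≡ true → ¬ (v ≡ zeroV)
  nonzero-elim {v} h e = not-elim h (zeroS-intro v e)

  nonzero-intro : ∀ {v} → ¬ (v ≡ zeroV) → nonzero v ≡ true
  nonzero-intro {v} h = not-intro (λ z → h (zeroS-elim v z))

  opaque
    meets : Pred N → Pred N → Bool
    meets S T = Finite.exists (finiteVect N) (λ v → nonzero v ∧ (S v ∧ T v))

    meets-intro : (S T : Pred N) → ∀ {v} → S v ≡ true → T v ≡ true → ¬ (v ≡ zeroV) → meets S T ≡ true
    meets-intro S T {v} s t h = Finite.exists-intro (finiteVect N) _ v (∧-intro (nonzero-intro h) (∧-intro s t))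

    meets-elim : (S T : Pred N) → meets S T ≡ true → ∃ λ v → S v ≡ true × T v ≡ true × ¬ (v ≡ zeroV)
    meets-elim S T h with Finite.exists-elim (finiteVect N) _ h
    ... | v , e = v , ∧-elimˡ (∧-elimʳ {nonzero v} e) , ∧-elimʳ {S v} (∧-elimʳ {nonzero v} e) , nonzero-elim (∧-elimˡ e)

  ¬meets⇒∩⊆zeroS : (S T : Pred N) → ¬ (meets S T ≡ true) → (S ∩ T) ⊆ zeroS
  ¬meets⇒∩⊆zeroS S T h v st with Finite._≟_ (finiteVect N) v zeroV
  ... | yes e = zeroS-intro v e
  ... | no k = ⊥-elim (h (meets-intro S T (∧-elimˡ st) (∧-elimʳ {S v} st) k))

  card-nonzero : {S : Pred N} → IsSubspace S → ∑[ v ∈ vects N ] ⟦ S v ∧ nonzero v ⟧ + 1 ≡ card S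
  card-nonzero {S} s = trans (cong (∑[ v ∈ vects N ] ⟦ S v ∧ nonzero v ⟧ +_) (sym (card-zeroS {N})))
    (trans (sym (∑-+ (vects N) _ _)) (∑-cong (vects N) λ {v} _ → split v))
    where
    split : ∀ v → ⟦ S v ∧ nonzero v ⟧ + ⟦ zeroS v ⟧ ≡ ⟦ S v ⟧
    split v with zeroS v in z | S v in e
    ... | true | true = refl
    ... | true | false = ⊥-elim (false⇒not-true e (zeroS⊆ s v z))
    ... | false | true = refl
    ... | false | false = refl

  module _ (𝓕 : Family N) where

    # : (Pred N → Bool) → ℕ
    # g = ∑[ P ∈ 𝓕 ] ⟦ g P ⟧

    #-mono : ∀ {g h} → (∀ {P} → P ∈ 𝓕 → g P ≡ true → h P ≡ true) → # g ≤ # h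
    #-mono f = ∑-mono 𝓕 λ i → ⟦⟧-mono (f i)

    degree : Pred N → ℕ
    degree A = # (sub? A)

    module _ (subspace : ∀ {P} → P ∈ 𝓕 → IsSubspace P) where

      -- Pairs of a member `P` and a nonzero `b` in both `S` and `P` are counted twice: a member
      -- occurs in at least `p` of them, and `bound` limits the members at each `b`. The factor
      -- `p ^ j` stands for divisions made at earlier stages.
      transversal : ∀ g {S} → IsSubspace S → ∀ j M →
        (∀ {P} → P ∈ 𝓕 → g P ≡ true → q ≤ card (S ∩ P)) →
        (∀ b → S b ≡ true → ¬ (b ≡ zeroV) → p ^ j * # (λ P → g P ∧ P b) ≤ M) →
        p ^ suc j * # g ≤ card S * M
      transversal g {S} s j M meet bound = begin
        p * p ^ j * # g                                              ≡⟨ reorder p (p ^ j) (# g) ⟩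
        p ^ j * (# g * p)                                            ≡⟨ cong (p ^ j *_) (sym (∑-*ʳ 𝓕 p _)) ⟩
        p ^ j * (∑[ P ∈ 𝓕 ] (⟦ g P ⟧ * p))                           ≤⟨ *-monoʳ-≤ (p ^ j) (∑-mono 𝓕 points) ⟩
        p ^ j * (∑[ P ∈ 𝓕 ] (∑[ b ∈ vects N ] (⟦ S b ∧ nonzero b ⟧ * ⟦ g P ∧ P b ⟧)))
          ≡⟨ cong (p ^ j *_) (∑-swap 𝓕 (vects N) _) ⟩
        p ^ j * (∑[ b ∈ vects N ] (∑[ P ∈ 𝓕 ] (⟦ S b ∧ nonzero b ⟧ * ⟦ g P ∧ P b ⟧)))
          ≡⟨ sym (∑-*ˡ (vects N) (p ^ j) _) ⟩
        ∑[ b ∈ vects N ] (p ^ j * (∑[ P ∈ 𝓕 ] (⟦ S b ∧ nonzero b ⟧ * ⟦ g P ∧ P b ⟧)))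
          ≤⟨ ∑-mono (vects N) (λ {b} _ → degrees b) ⟩
        ∑[ b ∈ vects N ] (⟦ S b ⟧ * M)                               ≡⟨ ∑-*ʳ (vects N) M _ ⟩
        card S * M ∎
        where
        open ≤-Reasoning
        reorder : ∀ a b c → a * b * c ≡ b * (c * a)
        reorder = solve 3 (λ a b c → a :* b :* c := b :* (c :* a)) refl
        points : ∀ {P} → P ∈ 𝓕 → ⟦ g P ⟧ * p ≤ ∑[ b ∈ vects N ] (⟦ S b ∧ nonzero b ⟧ * ⟦ g P ∧ P b ⟧)
        points {P} i with g P in e
        ... | false = z≤n
        ... | true = begin
          1 * p                                                ≡⟨ *-identityˡ p ⟩
          q ∸ 1                                                ≤⟨ ∸-monoˡ-≤ 1 (meet i e) ⟩
          card (S ∩ P) ∸ 1                                     ≡⟨ cong (_∸ 1) (sym (card-nonzero (∩-subspace s (subspace i)))) ⟩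
          ∑[ b ∈ vects N ] ⟦ (S ∩ P) b ∧ nonzero b ⟧ + 1 ∸ 1   ≡⟨ m+n∸n≡m (∑[ b ∈ vects N ] ⟦ (S ∩ P) b ∧ nonzero b ⟧) 1 ⟩
          ∑[ b ∈ vects N ] ⟦ (S ∩ P) b ∧ nonzero b ⟧           ≡⟨ ∑-cong (vects N) (λ {b} _ → split (S b) (P b) (nonzero b)) ⟩
          ∑[ b ∈ vects N ] (⟦ S b ∧ nonzero b ⟧ * ⟦ P b ⟧)     ∎
          where
          split : ∀ a b c → ⟦ (a ∧ b) ∧ c ⟧ ≡ ⟦ a ∧ c ⟧ * ⟦ b ⟧
          split true true c = sym (*-identityʳ _)
          split true false c = sym (*-zeroʳ ⟦ c ⟧)
          split false b c = refl
        degrees : ∀ b → p ^ j * (∑[ P ∈ 𝓕 ] (⟦ S b ∧ nonzero b ⟧ * ⟦ g P ∧ P b ⟧)) ≤ ⟦ S b ⟧ * M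
        degrees b with S b in e | nonzero b in e'
        ... | false | _ = ≤-reflexive (trans (cong (p ^ j *_) (∑-zero 𝓕)) (*-zeroʳ (p ^ j)))
        ... | true | false = ≤-trans (≤-reflexive (trans (cong (p ^ j *_) (∑-zero 𝓕)) (*-zeroʳ (p ^ j)))) z≤n
        ... | true | true = begin
          p ^ j * (∑[ P ∈ 𝓕 ] (1 * ⟦ g P ∧ P b ⟧)) ≡⟨ cong (p ^ j *_) (∑-cong 𝓕 (λ _ → *-identityˡ _)) ⟩
          p ^ j * # (λ P → g P ∧ P b)               ≤⟨ bound b e (nonzero-elim e') ⟩
          M                                         ≡⟨ sym (*-identityˡ M) ⟩
          1 * M ∎

      degree-⊕ : ∀ {A} → IsSubspace A → ∀ b → # (λ P → sub? A P ∧ P b) ≤ degree (A ⊕ b)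
      degree-⊕ {A} a b = #-mono λ {P} i h →
        sub?-intro (A ⊕ b) P (⊕-least a b (subspace i) (sub?-elim A P (∧-elimˡ h)) (∧-elimʳ {sub? A P} h))

      module _ (distinct : Distinct 𝓕) (dim : ∀ {P} → P ∈ 𝓕 → card P ≡ q ^ m)
               (intersecting : ∀ {P Q} → P ∈ 𝓕 → Q ∈ 𝓕 → q ≤ card (P ∩ Q))
               -- The covering number enters in this form: a subspace too small to be a cover misses
               -- some member.
               (avoid : ∀ {A} → IsSubspace A → ∀ {a} → card A ≡ q ^ a → a < m →
                 ∃ λ B → B ∈ 𝓕 × (A ∩ B) ⊆ zeroS) where

        outside : (A B : Pred N) → ∀ {b} → (A ∩ B) ⊆ zeroS → B b ≡ true → ¬ (b ≡ zeroV) → ¬ (A b ≡ true)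
        outside A B {b} h Bb b≢0 Ab = b≢0 (zeroS-elim b (h b (∧-intro Ab Bb)))

        same-card : ∀ {A P} → P ∈ 𝓕 → card A ≡ q ^ m → A ⊆ P → P ⊆ A
        same-card i e f = ⊆-card f (≤-reflexive (trans (dim i) (sym e)))

        -- A member containing `A` has the same size, hence equals it, and distinct members cannot
        -- both do so.
        degree≤1 : (A : Pred N) → card A ≡ q ^ m → degree A ≤ 1
        degree≤1 A e = ∑-at-most-one 𝓕 (sub? A) distinct λ {P} {Q} i j hP hQ → ⊆-antisym
          (⊆-trans (same-card i e (sub?-elim A P hP)) (sub?-elim A Q hQ))
          (⊆-trans (same-card j e (sub?-elim A Q hQ)) (sub?-elim A P hP))

        module _ {E : Set} (M : ℕ)
          (base : ∀ {A} → IsSubspace A → card A ≡ q ^ r → E ⊎ (p * degree A ≤ M)) where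

          -- Induction on `j`, the distance of `a` from `r`. Some `B` misses `A`, every member
          -- through `A` meets `B` in a nonzero `b`, and `A ⊕ b` is one dimension larger; each stage
          -- contributes `q ^ m` for the size of `B` and one factor `p`. If `base` yields `E`
          -- anywhere, the whole recursion ends with it.
          chain : ∀ j {a A} → j + a ≡ r → IsSubspace A → card A ≡ q ^ a →
            E ⊎ (p ^ suc j * degree A ≤ (q ^ m) ^ j * M)
          chain zero {A = A} refl s e with base s e
          ... | inj₁ x = inj₁ x
          ... | inj₂ h = inj₂ (subst₂ _≤_ (cong (_* degree A) (sym (*-identityʳ p))) (sym (+-identityʳ M)) h)
          chain (suc j) {a} {A} ja s e with avoid s e (≤-trans (s≤s (m≤n+m a (suc j))) (≤-reflexive (cong suc ja)))
          ... | B , B∈ , disj with allOr (vects N) (λ {b} _ → extend b)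
            where
            extend : ∀ b → E ⊎ (B b ≡ true → ¬ (b ≡ zeroV) → p ^ suc j * # (λ P → sub? A P ∧ P b) ≤ (q ^ m) ^ j * M)
            extend b with B b in Bb | Finite._≟_ (finiteVect N) b zeroV
            ... | false | _ = inj₂ λ ()
            ... | true | yes b≡0 = inj₂ λ _ b≢0 → ⊥-elim (b≢0 b≡0)
            ... | true | no b≢0 with chain j (trans (+-suc j a) ja) (⊕-subspace s b)
                                       (trans (card-⊕ s {b} (outside A B {b} disj Bb b≢0)) (cong (q *_) e))
            ...   | inj₁ x = inj₁ x
            ...   | inj₂ h = inj₂ λ _ _ → ≤-trans (*-monoʳ-≤ (p ^ suc j) (degree-⊕ s b)) h
          ...   | inj₁ x = inj₁ x
          ...   | inj₂ h = inj₂ (≤-trans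
            (transversal (sub? A) (subspace B∈) (suc j) _ (λ i _ → intersecting B∈ i)
              (λ b → h (Finite.complete (finiteVect N) b)))
            (≤-reflexive (trans (cong (_* ((q ^ m) ^ j * M)) (dim B∈)) (sym (*-assoc (q ^ m) ((q ^ m) ^ j) M)))))

        -- No escape occurs here. Each nonzero `b` of the missed `B` completes `A` to dimension `m`,
        -- where at most one member remains, and `B` has `q ^ m` vectors.
        base-trivial : ∀ {A} → IsSubspace A → card A ≡ q ^ r → ⊥ ⊎ (p * degree A ≤ q ^ m)
        base-trivial {A} s e with avoid s e ≤-refl
        ... | B , B∈ , disj = inj₂ (subst₂ _≤_ (cong (_* degree A) (*-identityʳ p)) (trans (*-identityʳ _) (dim B∈))
          (transversal (sub? A) (subspace B∈) 0 1 (λ i _ → intersecting B∈ i) λ b Bb b≢0 →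
            ≤-trans (≤-reflexive (*-identityˡ _)) (≤-trans (degree-⊕ s b)
              (degree≤1 (A ⊕ b) (trans (card-⊕ s {b} (outside A B {b} disj Bb b≢0)) (cong (q *_) e))))))

        #-meets : ∀ {D} → IsSubspace D → card D ≤ q ^ r → p ^ m * # (meets D) ≤ q ^ r * (q ^ m) ^ r
        #-meets {D} s e = ≤-trans (transversal (meets D) s r ((q ^ m) ^ r) meet bound) (*-monoˡ-≤ _ e)
          where
          meet : ∀ {P} → P ∈ 𝓕 → meets D P ≡ true → q ≤ card (D ∩ P)
          meet {P} i h with meets-elim D P h
          ... | v , Dv , Pv , v≢0 = card≥q (∩-subspace s (subspace i)) (∧-intro Dv Pv) v≢0
          -- Members through `b` contain its line, so `chain` applies from dimension 1, that is,
          -- with `n` stages above the base. Taking points from `D`, with at most `q ^ r` vectors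
          -- instead of `q ^ m`, is what saves a factor `q`.
          bound : ∀ b → D b ≡ true → ¬ (b ≡ zeroV) → p ^ r * # (λ P → meets D P ∧ P b) ≤ (q ^ m) ^ r
          bound b _ b≢0 with chain (q ^ m) base-trivial n {1} (+-comm n 1) (line-subspace b) (trans (card-line b≢0) (sym (*-identityʳ q)))
          ... | inj₂ h = ≤-trans (*-monoʳ-≤ (p ^ r) (#-mono λ {P} i h →
                  sub?-intro (line b) P (line-least (subspace i) (∧-elimʳ {meets D P} h))))
                (≤-trans h (≤-reflexive (*-comm ((q ^ m) ^ n) (q ^ m))))

        -- The way out of `base-good`: no member that misses `A` leaves `X`, so its sharper bound
        -- has no third member to work with.
        record Good : Set where
          field
            A X : Pred N
            A-subspace : IsSubspace A
            A-card : card A ≡ q ^ r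
            X-subspace : IsSubspace X
            X-card : card X ≡ q ^ (r + m)
            captures : ∀ {P} → P ∈ 𝓕 → ¬ (meets A P ≡ true) → P ⊆ X

        -- The gain over `base-trivial` is `q ^ r` in place of `q ^ m`. Members through `A` all lie
        -- in `A ⊹ B`, so they meet a member `C` that misses `A` and leaves `A ⊹ B` already in the
        -- smaller space `C ∩ (A ⊹ B)`.
        base-good : ∀ {A} → IsSubspace A → card A ≡ q ^ r → Good ⊎ (p * degree A ≤ q ^ r)
        base-good {A} s e with avoid s e ≤-refl
        ... | B , B∈ , disj with search∈ 𝓕 (λ P → not (meets A P) ∧ not (sub? P (A ⊹ B)))
        ...   | inj₂ none = inj₁ (record
                { A = A ; X = A ⊹ B ; A-subspace = s ; A-card = e
                ; X-subspace = ⊹-subspace s (subspace B∈)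
                ; X-card = card-direct s (subspace B∈) disj {r} {m} e (dim B∈)
                ; captures = captures })
          where
          captures : ∀ {P} → P ∈ 𝓕 → ¬ (meets A P ≡ true) → P ⊆ (A ⊹ B)
          captures {P} i h with sub? P (A ⊹ B) in k
          ... | true = sub?-elim P (A ⊹ B) k
          ... | false = ⊥-elim (false⇒not-true (none i) (∧-intro (not-intro h) (not-intro (false⇒not-true k))))
        ...   | inj₁ (C , C∈ , h) = inj₂ (subst₂ _≤_ (cong (_* degree A) (*-identityʳ p)) refl
            (≤-trans (transversal (sub? A) S-subspace 0 1 meet bound) (≤-trans (≤-reflexive (*-identityʳ _)) S-card)))
          where
          X = A ⊹ B
          S = C ∩ X
          X-subspace = ⊹-subspace s (subspace B∈)
          S-subspace = ∩-subspace (subspace C∈) X-subspace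
          A∩C : (A ∩ C) ⊆ zeroS
          A∩C = ¬meets⇒∩⊆zeroS A C (not-elim (∧-elimˡ h))
          C⊈X : ¬ (C ⊆ X)
          C⊈X f = not-elim (∧-elimʳ {not (meets A C)} h) (sub?-intro C X f)
          S-card : card S ≤ q ^ r
          S-card with ⊈⇒∃ C X C⊈X
          ... | x , Cx , x∉X = *-cancelˡ-≤ q (≤-trans
            (proper-card S-subspace (subspace C∈) (∩⊆ˡ C X) Cx (λ k → x∉X (∧-elimʳ {C x} k)))
            (≤-reflexive (dim C∈)))
          -- `P` meets `B` in some nonzero `b`, and `A ⊕ b` already has dimension `m`, so it is all
          -- of `P`.
          inX : ∀ {P} → P ∈ 𝓕 → A ⊆ P → P ⊆ X
          inX {P} i f with nontrivial (intersecting B∈ i)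
          ... | b , BPb , b≢0 = ⊆-trans
            (same-card i (trans (card-⊕ s {b} (outside A B {b} disj (∧-elimˡ BPb) b≢0)) (cong (q *_) e))
              (⊕-least s b (subspace i) f (∧-elimʳ {B b} BPb)))
            (⊕-least s b X-subspace (⊆⊹ˡ s (subspace B∈)) (⊆⊹ʳ s (subspace B∈) b (∧-elimˡ BPb)))
          meet : ∀ {P} → P ∈ 𝓕 → sub? A P ≡ true → q ≤ card (S ∩ P)
          meet {P} i k = ≤-trans (intersecting C∈ i) (card-mono λ v CPv → ∧-intro
            (∧-intro (∧-elimˡ CPv) (inX i (sub?-elim A P k) v (∧-elimʳ {C v} CPv))) (∧-elimʳ {C v} CPv))
          bound : ∀ b → S b ≡ true → ¬ (b ≡ zeroV) → 1 * # (λ P → sub? A P ∧ P b) ≤ 1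
          bound b Sb b≢0 = ≤-trans (≤-reflexive (*-identityˡ _)) (≤-trans (degree-⊕ s b)
            (degree≤1 (A ⊕ b) (trans (card-⊕ s {b} (outside A C {b} A∩C (∧-elimˡ Sb) b≢0)) (cong (q *_) e))))

        -- The factor 2 allows for a family whose members each meet one of two subspaces of
        -- dimension at most `r`, as in the last case of `dichotomy`.
        SmallFamily : Set
        SmallFamily = p ^ m * length 𝓕 ≤ 2 * (q ^ r * (q ^ m) ^ r)

        Contained : Set
        Contained = ∃ λ X → IsSubspace X × card X ≡ q ^ (r + m) × (∀ {P} → P ∈ 𝓕 → P ⊆ X)

        dichotomy : SmallFamily ⊎ Contained
        -- Every member contains the zero subspace, so starting there counts the whole family.
        dichotomy with chain (q ^ r) base-good r {0} (+-identityʳ r) zeroS-subspace (card-zeroS {N})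
        ... | inj₂ h = inj₁ (≤-trans (*-monoʳ-≤ (p ^ m) all) (≤-trans h (≤-trans (≤-reflexive (*-comm ((q ^ m) ^ r) (q ^ r))) (m≤n*m _ 2))))
          where
          all : length 𝓕 ≤ degree zeroS
          all = ≤-reflexive (trans (sym (∑-one 𝓕)) (∑-cong 𝓕 λ {P} i → sym (cong ⟦_⟧ (sub?-intro zeroS P (zeroS⊆ (subspace i))))))
        ... | inj₁ good with search∈ 𝓕 (λ P → not (sub? P (Good.X good)))
        ...   | inj₂ none = inj₂ (X , X-subspace , X-card , λ i → in-X i)
          where
          open Good good
          in-X : ∀ {P} → P ∈ 𝓕 → P ⊆ X
          in-X {P} i with sub? P X in k
          ... | true = sub?-elim P X k
          ... | false = ⊥-elim (false⇒not-true (none i) (not-intro (false⇒not-true k)))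
        ...   | inj₁ (C , C∈ , h) = inj₁ (begin
            p ^ m * length 𝓕                              ≤⟨ *-monoʳ-≤ (p ^ m) cover ⟩
            p ^ m * (# (meets D) + # (meets A))           ≡⟨ *-distribˡ-+ (p ^ m) _ _ ⟩
            p ^ m * # (meets D) + p ^ m * # (meets A)     ≤⟨ +-mono-≤ (#-meets D-subspace D-card) (#-meets A-subspace (≤-reflexive A-card)) ⟩
            K + K                                         ≡⟨ cong (K +_) (sym (+-identityʳ K)) ⟩
            2 * K ∎)
          where
          open ≤-Reasoning
          open Good good
          K = q ^ r * (q ^ m) ^ r
          D = C ∩ X
          D-subspace = ∩-subspace (subspace C∈) X-subspace
          D-card : card D ≤ q ^ r
          D-card with ⊈⇒∃ C X (λ f → not-elim h (sub?-intro C X f))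
          ... | x , Cx , x∉X = *-cancelˡ-≤ q (≤-trans
            (proper-card D-subspace (subspace C∈) (∩⊆ˡ C X) Cx (λ k → x∉X (∧-elimʳ {C x} k)))
            (≤-reflexive (dim C∈)))
          -- A member that misses `A` lies in `X`, so its intersection with `C` lies in `D`.
          one : ∀ {P} → P ∈ 𝓕 → 1 ≤ ⟦ meets D P ⟧ + ⟦ meets A P ⟧
          one {P} i with meets A P in k
          ... | true = m≤n+m 1 _
          ... | false with nontrivial (intersecting C∈ i)
          ...   | v , CPv , v≢0 rewrite meets-intro D P
                  (∧-intro (∧-elimˡ CPv) (captures i (false⇒not-true k) v (∧-elimʳ {C v} CPv))) (∧-elimʳ {C v} CPv) v≢0 = s≤s z≤n
          cover : length 𝓕 ≤ # (meets D) + # (meets A)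
          cover = ≤-trans (≤-reflexive (sym (∑-one 𝓕))) (≤-trans (∑-mono 𝓕 one) (≤-reflexive (∑-+ 𝓕 _ _)))

-- Gaussian binomial coefficients

-- Bernoulli's inequality for the power j + 1 of p / (p + 1), cleared of denominators, with `d` for
-- p - (j + 1). One factor `suc p` is traded for `p` by raising `d` by one, and `weak` treats the
-- remaining factors by recursion.
bernoulli : ∀ p j d → suc j + d ≡ p → suc p ^ suc j * d < p ^ suc (suc j)
bernoulli p j d e = begin-strict
  suc p * suc p ^ j * d       ≡⟨ solve 3 (λ a b c → a :* b :* c := b :* (a :* c)) refl (suc p) (suc p ^ j) d ⟩
  suc p ^ j * (suc p * d)     <⟨ *-monoʳ-< (suc p ^ j) {{m^n≢0 (suc p) j}} step ⟩
  suc p ^ j * (p * suc d)     ≡⟨ solve 3 (λ a b c → a :* (b :* c) := b :* (a :* c)) refl (suc p ^ j) p (suc d) ⟩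
  p * (suc p ^ j * suc d)     ≤⟨ *-monoʳ-≤ p (weak j e) ⟩
  p * p ^ suc j ∎
  where
  open ≤-Reasoning
  step : suc p * d < p * suc d
  step = subst (suc p * d <_) (sym (*-suc p d)) (+-monoˡ-< (p * d) (subst (d <_) e (s≤s (m≤n+m d j))))
  weak : ∀ j → suc j + d ≡ p → suc p ^ j * suc d ≤ p ^ suc j
  weak zero refl = ≤-reflexive (trans (+-identityʳ _) (sym (*-identityʳ _)))
  weak (suc j) e = <⇒≤ (bernoulli p j (suc d) (trans (+-suc (suc j) d) e))

-- The 2 is absorbed by the `d` of `bernoulli`: the condition on `q` says exactly that (q - 1) - r
-- is at least 2.
twice-power : ∀ r q → 1 ≤ r → suc r + 2 ≤ q → 2 * q ^ r < (q ∸ 1) ^ suc r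
twice-power (suc j) (suc p) _ (s≤s h) = ≤-<-trans
  (≤-trans (≤-reflexive (*-comm 2 (suc p ^ suc j))) (*-monoʳ-≤ (suc p ^ suc j) 2≤d))
  (bernoulli p j (p ∸ suc j) (m+[n∸m]≡n (≤-trans (m≤m+n (suc j) 2) h)))
  where
  2≤d : 2 ≤ p ∸ suc j
  2≤d = ≤-trans (≤-reflexive (sym (m+n∸m≡n (suc j) 2))) (∸-monoˡ-≤ (suc j) h)

≤⇒≤ᵇ≡true : ∀ {a b} → a ≤ b → (a ≤ᵇ b) ≡ true
≤⇒≤ᵇ≡true {a} {b} h with a ≤ᵇ b | ≤⇒≤ᵇ h
... | true | _ = refl

module Gaussian (q : ℕ) {{q≢0 : NonZero q}} where

  -- The number of j-tuples in a y-dimensional space that are independent over an r-dimensional subspace.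
  fall : ℕ → ℕ → ℕ → ℕ
  fall y r zero = 1
  fall y r (suc j) = (q ^ y ∸ q ^ r) * fall y (suc r) j

  fall-last : ∀ y r j → fall y r (suc j) ≡ fall y r j * (q ^ y ∸ q ^ (r + j))
  fall-last y r zero = trans (*-identityʳ _) (trans (cong (λ z → q ^ y ∸ q ^ z) (sym (+-identityʳ r))) (sym (*-identityˡ _)))
  fall-last y r (suc j) = begin
    (q ^ y ∸ q ^ r) * fall y (suc r) (suc j)                          ≡⟨ cong ((q ^ y ∸ q ^ r) *_) (fall-last y (suc r) j) ⟩
    (q ^ y ∸ q ^ r) * (fall y (suc r) j * (q ^ y ∸ q ^ suc (r + j)))  ≡⟨ sym (*-assoc (q ^ y ∸ q ^ r) _ _) ⟩
    fall y r (suc j) * (q ^ y ∸ q ^ suc (r + j))                      ≡⟨ cong (λ z → fall y r (suc j) * (q ^ y ∸ q ^ z)) (sym (+-suc r j)) ⟩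
    fall y r (suc j) * (q ^ y ∸ q ^ (r + suc j)) ∎
    where open ≡-Reasoning

  -- This counts lifts from the quotient by an s-dimensional subspace: each of the `j` vectors has
  -- `q ^ s` of them.
  fall-shift : ∀ s y r j → fall (s + y) (s + r) j ≡ q ^ (s * j) * fall y r j
  fall-shift s y r zero = sym (trans (*-identityʳ _) (cong (q ^_) (*-zeroʳ s)))
  fall-shift s y r (suc j) = begin
    (q ^ (s + y) ∸ q ^ (s + r)) * fall (s + y) (suc (s + r)) j
      ≡⟨ cong₂ _*_ (trans (cong₂ _∸_ (^-distribˡ-+-* q s y) (^-distribˡ-+-* q s r)) (sym (*-distribˡ-∸ (q ^ s) (q ^ y) (q ^ r))))
           (trans (cong (λ z → fall (s + y) z j) (sym (+-suc s r))) (fall-shift s y (suc r) j)) ⟩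
    q ^ s * (q ^ y ∸ q ^ r) * (q ^ (s * j) * fall y (suc r) j)
      ≡⟨ solve 4 (λ a b c d → a :* b :* (c :* d) := a :* c :* (b :* d)) refl (q ^ s) (q ^ y ∸ q ^ r) (q ^ (s * j)) (fall y (suc r) j) ⟩
    q ^ s * q ^ (s * j) * fall y r (suc j)
      ≡⟨ cong (_* fall y r (suc j)) (sym (trans (cong (q ^_) (*-suc s j)) (^-distribˡ-+-* q s (s * j)))) ⟩
    q ^ (s * suc j) * fall y r (suc j) ∎
    where open ≡-Reasoning

  fall-zero : ∀ a b → a < b → fall a 0 b ≡ 0
  fall-zero a (suc b) (s≤s a≤b) = trans (fall-last a 0 b) (trans (cong (fall a 0 b *_) vanish) (*-zeroʳ (fall a 0 b)))
    where
    vanish : q ^ a ∸ q ^ b ≡ 0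
    vanish = m≤n⇒m∸n≡0 (^-monoʳ-≤ q a≤b)

  -- An independent `b`-tuple amounts to its span and a basis of it; this recovers the product
  -- formula from the q-Pascal rule. In the induction both Pascal terms share the factor `K`, and
  -- their cofactors telescope.
  gauss-fall : ∀ a b → gauss q a b * fall b 0 b ≡ fall a 0 b
  gauss-fall a zero = refl
  gauss-fall zero (suc b) = refl
  gauss-fall (suc a) (suc b) = begin
    (gauss q a b + q ^ suc b * gauss q a (suc b)) * fall (suc b) 0 (suc b)
      ≡⟨ *-distribʳ-+ (fall (suc b) 0 (suc b)) (gauss q a b) _ ⟩
    gauss q a b * fall (suc b) 0 (suc b) + q ^ suc b * gauss q a (suc b) * fall (suc b) 0 (suc b)
      ≡⟨ cong₂ _+_ left right ⟩
    K * (q ^ suc b ∸ 1) + K * (q * (q ^ a ∸ q ^ b))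
      ≡⟨ sym (*-distribˡ-+ K _ _) ⟩
    K * ((q ^ suc b ∸ 1) + q * (q ^ a ∸ q ^ b))
      ≡⟨ telescope ⟩
    K * (q ^ suc a ∸ 1)
      ≡⟨ *-comm K _ ⟩
    (q ^ suc a ∸ 1) * K
      ≡⟨ sym (first a) ⟩
    fall (suc a) 0 (suc b) ∎
    where
    open ≡-Reasoning
    K = q ^ b * fall a 0 b
    first : ∀ a → fall (suc a) 0 (suc b) ≡ (q ^ suc a ∸ 1) * (q ^ b * fall a 0 b)
    first a = cong ((q ^ suc a ∸ 1) *_) (trans (fall-shift 1 a 0 b) (cong (λ z → q ^ z * fall a 0 b) (*-identityˡ b)))
    left : gauss q a b * fall (suc b) 0 (suc b) ≡ K * (q ^ suc b ∸ 1)
    left = begin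
      gauss q a b * fall (suc b) 0 (suc b)                       ≡⟨ cong (gauss q a b *_) (first b) ⟩
      gauss q a b * ((q ^ suc b ∸ 1) * (q ^ b * fall b 0 b))
        ≡⟨ solve 4 (λ g x y f → g :* (x :* (y :* f)) := y :* (g :* f) :* x) refl (gauss q a b) (q ^ suc b ∸ 1) (q ^ b) (fall b 0 b) ⟩
      q ^ b * (gauss q a b * fall b 0 b) * (q ^ suc b ∸ 1)       ≡⟨ cong (λ z → q ^ b * z * (q ^ suc b ∸ 1)) (gauss-fall a b) ⟩
      K * (q ^ suc b ∸ 1) ∎
    right : q ^ suc b * gauss q a (suc b) * fall (suc b) 0 (suc b) ≡ K * (q * (q ^ a ∸ q ^ b))
    right = begin
      q ^ suc b * gauss q a (suc b) * fall (suc b) 0 (suc b)     ≡⟨ *-assoc (q ^ suc b) _ _ ⟩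
      q ^ suc b * (gauss q a (suc b) * fall (suc b) 0 (suc b))   ≡⟨ cong (q ^ suc b *_) (trans (gauss-fall a (suc b)) (fall-last a 0 b)) ⟩
      q * q ^ b * (fall a 0 b * (q ^ a ∸ q ^ b))
        ≡⟨ solve 4 (λ q x f y → q :* x :* (f :* y) := x :* f :* (q :* y)) refl q (q ^ b) (fall a 0 b) (q ^ a ∸ q ^ b) ⟩
      K * (q * (q ^ a ∸ q ^ b)) ∎
    telescope : K * ((q ^ suc b ∸ 1) + q * (q ^ a ∸ q ^ b)) ≡ K * (q ^ suc a ∸ 1)
    telescope with b ≤? a
    ... | yes b≤a = cong (K *_) (begin
      (q ^ suc b ∸ 1) + q * (q ^ a ∸ q ^ b)         ≡⟨ cong ((q ^ suc b ∸ 1) +_) (*-distribˡ-∸ q (q ^ a) (q ^ b)) ⟩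
      (q ^ suc b ∸ 1) + (q ^ suc a ∸ q ^ suc b)     ≡⟨ sym (+-∸-comm (q ^ suc a ∸ q ^ suc b) (m^n>0 q (suc b))) ⟩
      q ^ suc b + (q ^ suc a ∸ q ^ suc b) ∸ 1       ≡⟨ cong (_∸ 1) (m+[n∸m]≡n (^-monoʳ-≤ q (s≤s b≤a))) ⟩
      q ^ suc a ∸ 1 ∎)
    -- Truncated subtraction prevents the telescoping here, but `K` vanishes.
    ... | no b≰a rewrite fall-zero a b (≰⇒> b≰a) | *-zeroʳ (q ^ b) = refl

  -- The second Pascal term contributes a factor `q ^ b` for each unit of `e`; the first term is
  -- dropped until `e` is used up.
  gauss-lower : ∀ b e → q ^ (b * e) ≤ gauss q (e + b) b
  gauss-lower zero e = ≤-refl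
  gauss-lower (suc b) zero = ≤-trans (≤-trans (≤-reflexive (cong (q ^_) (trans (*-zeroʳ b) (sym (*-zeroʳ b))))) (gauss-lower b zero)) (m≤m+n _ _)
  gauss-lower (suc b) (suc e) = begin
    q ^ (suc b * suc e)                     ≡⟨ trans (cong (q ^_) (*-suc (suc b) e)) (^-distribˡ-+-* q (suc b) (suc b * e)) ⟩
    q ^ suc b * q ^ (suc b * e)             ≤⟨ *-monoʳ-≤ (q ^ suc b) (gauss-lower (suc b) e) ⟩
    q ^ suc b * gauss q (e + suc b) (suc b) ≤⟨ m≤n+m _ (gauss q (e + suc b) b) ⟩
    gauss q (suc e + suc b) (suc b) ∎
    where open ≤-Reasoning

  gauss-positive : ∀ {a b} → b ≤ a → 1 ≤ gauss q a b
  gauss-positive {a} {b} h = ≤-trans (m^n>0 q (b * (a ∸ b)))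
    (≤-trans (gauss-lower b (a ∸ b)) (≤-reflexive (cong (λ z → gauss q z b) (m∸n+n≡m h))))

  -- Up to a power of `q` the difference is the first Pascal term, positive because `m ≤ a`. For k =
  -- 0 this says that lowering dim (X ∩ W₁) by one increases the count.
  gauss-shift-< : ∀ m s a → m ≤ a → q ^ (suc m * suc s) * gauss q a (suc m) < q ^ (suc m * s) * gauss q (suc a) (suc m)
  gauss-shift-< m s a h = begin-strict
    q ^ (suc m * suc s) * gauss q a (suc m)
      ≡⟨ cong (_* gauss q a (suc m)) (trans (cong (q ^_) (trans (*-suc (suc m) s) (+-comm (suc m) _))) (^-distribˡ-+-* q (suc m * s) (suc m))) ⟩
    q ^ (suc m * s) * q ^ suc m * gauss q a (suc m)     ≡⟨ *-assoc (q ^ (suc m * s)) _ _ ⟩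
    q ^ (suc m * s) * (q ^ suc m * gauss q a (suc m))   <⟨ *-monoʳ-< (q ^ (suc m * s)) {{m^n≢0 q (suc m * s)}} (+-monoˡ-≤ _ (gauss-positive h)) ⟩
    q ^ (suc m * s) * gauss q (suc a) (suc m) ∎
    where open ≤-Reasoning

  gauss-shift-≤ : ∀ m s e a → q ^ (suc m * (e + s)) * gauss q a (suc m) ≤ q ^ (suc m * s) * gauss q (e + a) (suc m)
  gauss-shift-≤ m s zero a = ≤-refl
  gauss-shift-≤ m s (suc e) a with m ≤? e + a
  ... | yes h = ≤-trans (subst (λ z → q ^ (suc m * z) * gauss q a (suc m) ≤ q ^ (suc m * suc s) * gauss q (e + a) (suc m))
                   (+-suc e s) (gauss-shift-≤ m (suc s) e a))
                 (<⇒≤ (gauss-shift-< m s (e + a) h))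
  -- The strict shift needs `m ≤ e + a`. Otherwise `a < suc m`, and the left side is zero.
  ... | no h = ≤-trans (≤-reflexive (trans (cong (q ^ (suc m * (suc e + s)) *_) (gauss-vanish a (suc m)
                 (≤-trans (s≤s (m≤n+m a e)) (m≤n⇒m≤1+n (≰⇒> h))))) (*-zeroʳ (q ^ (suc m * (suc e + s)))))) z≤n
    where
    gauss-vanish : ∀ a b → a < b → gauss q a b ≡ 0
    gauss-vanish zero (suc b) _ = refl
    gauss-vanish (suc a) (suc b) (s≤s h) = cong₂ _+_ (gauss-vanish a b h)
      (trans (cong (q ^ suc b *_) (gauss-vanish a (suc b) (m≤n⇒m≤1+n h))) (*-zeroʳ (q ^ suc b)))

  -- The nonzero branch of Ncount.
  typeCount : (m k d s : ℕ) → ℕ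
  typeCount m k d s = q ^ ((m ∸ k) * (s ∸ k)) * gauss q (d ∸ s) (m ∸ k) * gauss q s k

  Ncount≡ : ∀ {m k d s n l} → k ≤ s → s ≤ l → k ≤ m → s ≤ d → m ∸ k ≤ d ∸ s → d ∸ s ≤ n →
    Ncount q m k d s n l ≡ typeCount m k d s
  Ncount≡ h₁ h₂ h₃ h₄ h₅ h₆
    rewrite ≤⇒≤ᵇ≡true h₁ | ≤⇒≤ᵇ≡true h₂ | ≤⇒≤ᵇ≡true h₃ | ≤⇒≤ᵇ≡true h₄ | ≤⇒≤ᵇ≡true h₅ | ≤⇒≤ᵇ≡true h₆ = refl

  -- Both sides count adapted bases: on the left by subspaces, each with the same number of bases,
  -- on the right directly.
  typeCount-fall : ∀ {m k d s} → k ≤ m → k ≤ s → s ≤ d →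
    typeCount m k d s * (fall k 0 k * fall m k (m ∸ k)) ≡ fall s 0 k * fall d s (m ∸ k)
  typeCount-fall {m} {k} {d} {s} k≤m k≤s s≤d = begin
    q ^ (j * (s ∸ k)) * gauss q (d ∸ s) j * gauss q s k * (fall k 0 k * fall m k j)
      ≡⟨ cong (λ z → q ^ (j * (s ∸ k)) * gauss q (d ∸ s) j * gauss q s k * (fall k 0 k * z)) (based k≤m) ⟩
    q ^ (j * (s ∸ k)) * gauss q (d ∸ s) j * gauss q s k * (fall k 0 k * (q ^ (k * j) * fall j 0 j))
      ≡⟨ solve 6 (λ a b c d e f → a :* b :* c :* (d :* (e :* f)) := c :* d :* (a :* e :* (b :* f))) refl
           (q ^ (j * (s ∸ k))) (gauss q (d ∸ s) j) (gauss q s k) (fall k 0 k) (q ^ (k * j)) (fall j 0 j) ⟩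
    gauss q s k * fall k 0 k * (q ^ (j * (s ∸ k)) * q ^ (k * j) * (gauss q (d ∸ s) j * fall j 0 j))
      ≡⟨ cong₂ _*_ (gauss-fall s k) (cong₂ _*_ powers (gauss-fall (d ∸ s) j)) ⟩
    fall s 0 k * (q ^ (s * j) * fall (d ∸ s) 0 j)
      ≡⟨ cong (fall s 0 k *_) (sym (based s≤d)) ⟩
    fall s 0 k * fall d s j ∎
    where
    open ≡-Reasoning
    j = m ∸ k
    based : ∀ {x y} → x ≤ y → fall y x j ≡ q ^ (x * j) * fall (y ∸ x) 0 j
    based {x} {y} h = trans (cong₂ (λ a b → fall a b j) (sym (m+[n∸m]≡n h)) (sym (+-identityʳ x))) (fall-shift x (y ∸ x) 0 j)
    powers : q ^ (j * (s ∸ k)) * q ^ (k * j) ≡ q ^ (s * j)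
    powers = trans (sym (^-distribˡ-+-* q (j * (s ∸ k)) (k * j))) (cong (q ^_)
      (trans (cong (_+ k * j) (*-comm j (s ∸ k))) (trans (sym (*-distribʳ-+ j (s ∸ k) k)) (cong (_* j) (m∸n+n≡m k≤s)))))

  fall-positive : 1 < q → ∀ y r j → r + j ≤ y → 1 ≤ fall y r j
  fall-positive _ y r zero h = ≤-refl
  fall-positive 1<q y r (suc j) h = *-mono-≤
    (m<n⇒0<n∸m (^-monoʳ-< q 1<q (≤-trans (≤-trans (s≤s (m≤m+n r j)) (≤-reflexive (sym (+-suc r j)))) h)))
    (fall-positive 1<q y (suc r) j (≤-trans (≤-reflexive (sym (+-suc r j))) h))

-- Counting the subspaces of type (m, k)

module AdaptedBases {q : ℕ} (𝔽 : FiniteField q) where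
  open VectorSpace 𝔽
  open Dimension 𝔽
  open Gaussian q

  private variable
    N j : ℕ

  all∈ : Pred N → Vec (Vect N) j → Bool
  all∈ Y [] = true
  all∈ Y (x ∷ xs) = Y x ∧ all∈ Y xs

  independent : Pred N → Vec (Vect N) j → Bool
  independent R [] = true
  independent R (x ∷ xs) = not (R x) ∧ independent (R ⊕ x) xs

  extend : Pred N → Vec (Vect N) j → Pred N
  extend R [] = R
  extend R (x ∷ xs) = extend (R ⊕ x) xs

  all∈-mono : {Y Z : Pred N} → Y ⊆ Z → ∀ (xs : Vec (Vect N) j) → all∈ Y xs ≡ true → all∈ Z xs ≡ true
  all∈-mono f [] h = refl
  all∈-mono {Y = Y} f (x ∷ xs) h = ∧-intro (f x (∧-elimˡ h)) (all∈-mono f xs (∧-elimʳ {Y x} h))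

  all∈-∩ : (Y Z : Pred N) (xs : Vec (Vect N) j) → all∈ Y xs ≡ true → all∈ Z xs ≡ true → all∈ (Y ∩ Z) xs ≡ true
  all∈-∩ Y Z [] h k = refl
  all∈-∩ Y Z (x ∷ xs) h k = ∧-intro (∧-intro (∧-elimˡ {Y x} h) (∧-elimˡ {Z x} k))
    (all∈-∩ Y Z xs (∧-elimʳ {Y x} h) (∧-elimʳ {Z x} k))

  extend-subspace : {R : Pred N} → IsSubspace R → ∀ (xs : Vec (Vect N) j) → IsSubspace (extend R xs)
  extend-subspace r [] = r
  extend-subspace r (x ∷ xs) = extend-subspace (⊕-subspace r x) xs

  ⊆extend : {R : Pred N} → IsSubspace R → ∀ (xs : Vec (Vect N) j) → R ⊆ extend R xs
  ⊆extend r [] = ⊆-refl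
  ⊆extend r (x ∷ xs) = ⊆-trans (⊆⊕ r x) (⊆extend (⊕-subspace r x) xs)

  extend-contains : {R : Pred N} → IsSubspace R → ∀ (xs : Vec (Vect N) j) → all∈ (extend R xs) xs ≡ true
  extend-contains r [] = refl
  extend-contains r (x ∷ xs) = ∧-intro (⊆extend (⊕-subspace r x) xs x (∈⊕ r x)) (extend-contains (⊕-subspace r x) xs)

  extend-least : {R P : Pred N} → IsSubspace R → IsSubspace P → R ⊆ P → ∀ (xs : Vec (Vect N) j) →
    all∈ P xs ≡ true → extend R xs ⊆ P
  extend-least r s f [] h = f
  extend-least {P = P} r s f (x ∷ xs) h =
    extend-least (⊕-subspace r x) s (⊕-least r x s f (∧-elimˡ h)) xs (∧-elimʳ {P x} h)

  card-extend : {R : Pred N} → IsSubspace R → ∀ {a} → card R ≡ q ^ a → ∀ (xs : Vec (Vect N) j) →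
    independent R xs ≡ true → card (extend R xs) ≡ q ^ (a + j)
  card-extend r {a} e [] h = trans e (cong (q ^_) (sym (+-identityʳ a)))
  card-extend {R = R} r {a} e (x ∷ xs) h = trans
    (card-extend (⊕-subspace r x) {suc a} (trans (card-⊕ r (not-elim (∧-elimˡ h))) (cong (q *_) e)) xs (∧-elimʳ {not (R x)} h))
    (cong (q ^_) (sym (+-suc a _)))

  independent-anti : {R S : Pred N} → IsSubspace R → IsSubspace S → R ⊆ S → ∀ (xs : Vec (Vect N) j) →
    independent S xs ≡ true → independent R xs ≡ true
  independent-anti r s f [] h = refl
  independent-anti {S = S} r s f (x ∷ xs) h = ∧-intro
    (not-intro (λ k → not-elim {S x} (∧-elimˡ h) (f x k)))
    (independent-anti (⊕-subspace r x) (⊕-subspace s x) (⊕-mono r s x f) xs (∧-elimʳ {not (S x)} h))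

  -- The vectors are independent over `U`, so by `⊕-∩-outside` none of them adds to the trace on
  -- `U`.
  extend-∩ : {R U : Pred N} → IsSubspace R → IsSubspace U → R ⊆ U → ∀ (xs : Vec (Vect N) j) →
    independent U xs ≡ true → (extend R xs ∩ U) ≐ R
  extend-∩ {R = R} {U} r u f [] h = ⊆-antisym (∩⊆ˡ R U) λ v k → ∧-intro k (f v k)
  extend-∩ {R = R} {U} r u f (x ∷ xs) h = ⊆-antisym to λ v k → ∧-intro (⊆extend r (x ∷ xs) v k) (f v k)
    where
    to : (extend (R ⊕ x) xs ∩ U) ⊆ R
    to v k = ≐⇒⊆ (⊕-∩-outside r u f (not-elim (∧-elimˡ h))) v (∧-intro
      (≐⇒⊆ (extend-∩ (⊕-subspace r x) (⊕-subspace u x) (⊕-mono r u x f) xs (∧-elimʳ {not (U x)} h)) v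
        (∧-intro (∧-elimˡ k) (⊆⊕ u x v (∧-elimʳ {extend (R ⊕ x) xs v} k))))
      (∧-elimʳ {extend (R ⊕ x) xs v} k))

  tuples : ∀ N j → List (Vec (Vect N) j)
  tuples N j = elemsVec (finiteVect N) j

  card-difference : (Y R : Pred N) → ∑[ x ∈ vects N ] ⟦ Y x ∧ not (R x) ⟧ ≡ card Y ∸ card (Y ∩ R)
  card-difference {N} Y R = begin
    D                               ≡⟨ sym (m+n∸n≡m D (card (Y ∩ R))) ⟩
    D + card (Y ∩ R) ∸ card (Y ∩ R) ≡⟨ cong (_∸ card (Y ∩ R)) (trans (sym (∑-+ (vects N) _ _)) (∑-cong (vects N) λ {x} _ → split (Y x) (R x))) ⟩
    card Y ∸ card (Y ∩ R) ∎
    where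
    open ≡-Reasoning
    D = ∑[ x ∈ vects N ] ⟦ Y x ∧ not (R x) ⟧
    split : ∀ a b → ⟦ a ∧ not b ⟧ + ⟦ a ∧ b ⟧ ≡ ⟦ a ⟧
    split true true = refl
    split true false = refl
    split false b = refl

  -- Only the trace of `R` on `Y` matters: the next vector has to avoid `Y ∩ R`, and by `⊕-modular`
  -- this trace grows by one dimension with each choice.
  count-independent : {Y R : Pred N} → IsSubspace Y → IsSubspace R → ∀ {y r} → card Y ≡ q ^ y → card (Y ∩ R) ≡ q ^ r →
    ∀ j → ∑[ xs ∈ tuples N j ] ⟦ all∈ Y xs ∧ independent R xs ⟧ ≡ fall y r j
  count-independent _ _ _ _ zero = refl
  count-independent {N} {Y} {R} sY sR {y} {r} eY eR (suc j) = begin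
    ∑[ xs ∈ tuples N (suc j) ] ⟦ all∈ Y xs ∧ independent R xs ⟧
      ≡⟨ ∑-elemsVec (finiteVect N) j _ ⟩
    ∑[ x ∈ vects N ] (∑[ xs ∈ tuples N j ] ⟦ (Y x ∧ all∈ Y xs) ∧ (not (R x) ∧ independent (R ⊕ x) xs) ⟧)
      ≡⟨ ∑-cong (vects N) (λ {x} _ → inner x) ⟩
    ∑[ x ∈ vects N ] (⟦ Y x ∧ not (R x) ⟧ * fall y (suc r) j)
      ≡⟨ ∑-*ʳ (vects N) (fall y (suc r) j) _ ⟩
    ∑[ x ∈ vects N ] ⟦ Y x ∧ not (R x) ⟧ * fall y (suc r) j
      ≡⟨ cong (_* fall y (suc r) j) (trans (card-difference Y R) (cong₂ _∸_ eY eR)) ⟩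
    fall y r (suc j) ∎
    where
    open ≡-Reasoning
    inner : ∀ x → ∑[ xs ∈ tuples N j ] ⟦ (Y x ∧ all∈ Y xs) ∧ (not (R x) ∧ independent (R ⊕ x) xs) ⟧
      ≡ ⟦ Y x ∧ not (R x) ⟧ * fall y (suc r) j
    inner x with Y x in Yx | R x in Rx
    ... | false | _ = ∑-zero (tuples N j)
    ... | true | true = trans (∑-cong (tuples N j) λ {xs} _ → cong ⟦_⟧ (Bool.∧-zeroʳ (all∈ Y xs))) (∑-zero (tuples N j))
    ... | true | false = trans (count-independent sY (⊕-subspace sR x) eY
      (trans (card-cong (⊕-modular sY sR Yx)) (trans (card-⊕ (∩-subspace sY sR) {x} (λ k → false⇒not-true Rx (∧-elimʳ {Y x} k))) (cong (q *_) eR))) j)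
      (sym (+-identityʳ _))

  module _ {N : ℕ} {X U : Pred N} (X-subspace : IsSubspace X) (U-subspace : IsSubspace U) (U⊆X : U ⊆ X)
           {d s : ℕ} (X-card : card X ≡ q ^ d) (U-card : card U ≡ q ^ s)
           {m k : ℕ} (k≤m : k ≤ m) (k≤s : k ≤ s) where

    i : ℕ
    i = m ∸ k

    -- The first `k` vectors are meant as a basis of the trace on `U`, the other `m ∸ k` as its
    -- completion to a basis of the whole.
    Flag : Set
    Flag = Vec (Vect N) k × Vec (Vect N) i

    flags : List Flag
    flags = concatMap (λ xs → map (xs ,_) (tuples N i)) (tuples N k)

    ∑-flags : ∀ (f : Vec (Vect N) k → Bool) (g : Vec (Vect N) i → Bool) →
      ∑[ t ∈ flags ] ⟦ f (proj₁ t) ∧ g (proj₂ t) ⟧ ≡ ∑[ xs ∈ tuples N k ] ⟦ f xs ⟧ * ∑[ ys ∈ tuples N i ] ⟦ g ys ⟧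
    ∑-flags f g = trans (∑-concatMap _ (tuples N k) _) (trans
      (∑-cong (tuples N k) λ {xs} _ → trans (∑-map (xs ,_) (tuples N i) _)
        (trans (∑-cong (tuples N i) λ {ys} _ → ⟦⟧-∧ (f xs) (g ys)) (∑-*ˡ (tuples N i) ⟦ f xs ⟧ _)))
      (∑-*ʳ (tuples N k) _ _))

    -- The second part is independent over all of `U`, whatever `V` is; this keeps the span from
    -- acquiring further vectors of `U`.
    adapted : Pred N → Pred N → Flag → Bool
    adapted V Y (xs , ys) = (all∈ V xs ∧ independent zeroS xs) ∧ (all∈ Y ys ∧ independent U ys)

    count-adapted : {V Y : Pred N} → IsSubspace V → IsSubspace Y → ∀ {v y u} → card V ≡ q ^ v → card Y ≡ q ^ y →
      card (Y ∩ U) ≡ q ^ u → ∑[ t ∈ flags ] ⟦ adapted V Y t ⟧ ≡ fall v 0 k * fall y u i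
    count-adapted {V} {Y} sV sY eV eY eU = trans
      (∑-flags (λ xs → all∈ V xs ∧ independent zeroS xs) (λ ys → all∈ Y ys ∧ independent U ys))
      (cong₂ _*_ (count-independent sV zeroS-subspace eV trivial k) (count-independent sY U-subspace eY eU i))
      where
      trivial : card (V ∩ zeroS) ≡ 1
      trivial = trans (card-cong (⊆-antisym (∩⊆ʳ V zeroS) λ v h → ∧-intro (zeroS⊆ sV v h) h)) (card-zeroS {N})

    contains : Pred N → Flag → Bool
    contains P (xs , ys) = all∈ P xs ∧ all∈ P ys

    record Typed (P : Pred N) : Set where
      field
        subspace : IsSubspace P
        dim      : card P ≡ q ^ m
        dim-∩U   : card (P ∩ U) ≡ q ^ k
        ⊆X       : P ⊆ X

    -- The number of adapted bases of a single `Typed` subspace.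
    c : ℕ
    c = fall k 0 k * fall m k i

    c-positive : 1 ≤ c
    c-positive = *-mono-≤ (fall-positive 1<q k 0 k ≤-refl) (fall-positive 1<q m k i (≤-reflexive (m+[n∸m]≡n k≤m)))

    span : Flag → Pred N
    span (xs , ys) = extend (extend zeroS xs) ys

    module _ (t : Flag) (h : adapted U X t ≡ true) where
      private
        xs = proj₁ t
        ys = proj₂ t
        S = extend zeroS xs
        xs∈U = ∧-elimˡ {all∈ U xs} (∧-elimˡ h)
        xs-independent = ∧-elimʳ {all∈ U xs} (∧-elimˡ h)
        ys∈X = ∧-elimˡ {all∈ X ys} (∧-elimʳ {all∈ U xs ∧ independent zeroS xs} h)
        ys-independent = ∧-elimʳ {all∈ X ys} (∧-elimʳ {all∈ U xs ∧ independent zeroS xs} h)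
        S-subspace : IsSubspace S
        S-subspace = extend-subspace zeroS-subspace xs
        S⊆U : S ⊆ U
        S⊆U = extend-least zeroS-subspace U-subspace (zeroS⊆ U-subspace) xs xs∈U
        S-card : card S ≡ q ^ k
        S-card = card-extend zeroS-subspace {0} (card-zeroS {N}) xs xs-independent

      span-subspace : IsSubspace (span t)
      span-subspace = extend-subspace S-subspace ys

      span-card : card (span t) ≡ q ^ m
      span-card = trans (card-extend S-subspace {k} S-card ys
        (independent-anti S-subspace U-subspace S⊆U ys ys-independent)) (cong (q ^_) (m+[n∸m]≡n k≤m))

      span-typed : Typed (span t)
      span-typed = record
        { subspace = span-subspace
        ; dim = span-card
        ; dim-∩U = trans (card-cong (extend-∩ S-subspace U-subspace S⊆U ys ys-independent)) S-card
        ; ⊆X = extend-least S-subspace X-subspace (⊆-trans S⊆U U⊆X) ys ys∈X }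

      span-contains : contains (span t) t ≡ true
      span-contains = ∧-intro (all∈-mono (⊆extend S-subspace ys) xs (extend-contains zeroS-subspace xs))
        (extend-contains S-subspace ys)

      span-unique : ∀ {P} → Typed P → contains P t ≡ true → span t ≐ P
      span-unique {P} T e = ⊆-antisym span⊆P (⊆-card span⊆P (≤-reflexive (trans dim (sym span-card))))
        where
        open Typed T
        span⊆P : span t ⊆ P
        span⊆P = extend-least S-subspace subspace
          (extend-least zeroS-subspace subspace (zeroS⊆ subspace) xs (∧-elimˡ e)) ys (∧-elimʳ {all∈ P xs} e)

    -- A flag adapted to `U` and `X` that lies in `P` is the same as a flag adapted to `P ∩ U` and
    -- `P`.
    count-contained : ∀ {P} → Typed P → ∑[ t ∈ flags ] ⟦ adapted U X t ∧ contains P t ⟧ ≡ c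
    count-contained {P} T = trans (∑-cong flags λ {t} _ → cong ⟦_⟧ (iff⇒≡ (to t) (from t)))
      (count-adapted (∩-subspace subspace U-subspace) subspace dim-∩U dim dim-∩U)
      where
      open Typed T
      to : ∀ t → adapted U X t ∧ contains P t ≡ true → adapted (P ∩ U) P t ≡ true
      to (xs , ys) h = ∧-intro
        (∧-intro (all∈-∩ P U xs (∧-elimˡ h₂) (∧-elimˡ (∧-elimˡ {all∈ U xs ∧ independent zeroS xs} h₁)))
          (∧-elimʳ {all∈ U xs} (∧-elimˡ h₁)))
        (∧-intro (∧-elimʳ {all∈ P xs} h₂) (∧-elimʳ {all∈ X ys} (∧-elimʳ {all∈ U xs ∧ independent zeroS xs} h₁)))
        where
        h₁ = ∧-elimˡ {adapted U X (xs , ys)} h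
        h₂ = ∧-elimʳ {adapted U X (xs , ys)} h
      from : ∀ t → adapted (P ∩ U) P t ≡ true → adapted U X t ∧ contains P t ≡ true
      from (xs , ys) h = ∧-intro
        (∧-intro (∧-intro (all∈-mono (∩⊆ʳ P U) xs xs∈) (∧-elimʳ {all∈ (P ∩ U) xs} (∧-elimˡ h)))
          (∧-intro (all∈-mono ⊆X ys ys∈) (∧-elimʳ {all∈ P ys} h₂)))
        (∧-intro (all∈-mono (∩⊆ˡ P U) xs xs∈) ys∈)
        where
        h₂ = ∧-elimʳ {all∈ (P ∩ U) xs ∧ independent zeroS xs} h
        xs∈ = ∧-elimˡ {all∈ (P ∩ U) xs} (∧-elimˡ h)
        ys∈ = ∧-elimˡ {all∈ P ys} h₂

    s≤d : s ≤ d
    s≤d = ^-cancel-≤ (subst₂ _≤_ U-card X-card (card-mono U⊆X))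

    count-all : ∑[ t ∈ flags ] ⟦ adapted U X t ⟧ ≡ typeCount m k d s * c
    count-all = trans (count-adapted U-subspace X-subspace U-card X-card
        (trans (card-cong (⊆-antisym (∩⊆ʳ X U) λ v h → ∧-intro (U⊆X v h) h)) U-card))
      (sym (typeCount-fall k≤m k≤s s≤d))

    module _ (G : Family N) (typed : ∀ {P} → P ∈ G → Typed P) (distinct : Distinct G) where
      multiplicity : Flag → ℕ
      multiplicity t = ∑[ P ∈ G ] ⟦ adapted U X t ∧ contains P t ⟧

      double-count : ∑[ t ∈ flags ] (multiplicity t) ≡ length G * c
      double-count = begin
        ∑[ t ∈ flags ] (multiplicity t)                                      ≡⟨ ∑-swap flags G _ ⟩
        ∑[ P ∈ G ] (∑[ t ∈ flags ] ⟦ adapted U X t ∧ contains P t ⟧)     ≡⟨ ∑-cong G (λ P∈ → trans (count-contained (typed P∈)) (sym (*-identityˡ c))) ⟩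
        ∑[ P ∈ G ] (1 * c)                                               ≡⟨ ∑-*ʳ G c (λ _ → 1) ⟩
        ∑[ P ∈ G ] 1 * c                                                 ≡⟨ cong (_* c) (∑-one G) ⟩
        length G * c ∎
        where open ≡-Reasoning

      -- An adapted flag spans every typed subspace containing it, so two members that contain it
      -- coincide.
      multiplicity≤ : ∀ t → multiplicity t ≤ ⟦ adapted U X t ⟧
      multiplicity≤ t with adapted U X t in h
      ... | false = ≤-reflexive (∑-zero G)
      ... | true = ∑-at-most-one G (λ P → contains P t) distinct λ P∈ Q∈ hP hQ v →
        trans (sym (span-unique t h (typed P∈) hP v)) (span-unique t h (typed Q∈) hQ v)

      cancel-c : ∀ {a b} → a * c ≤ b * c → a ≤ b
      cancel-c {a} {b} = *-cancelʳ-≤ a b c {{>-nonZero c-positive}}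

      length≤typeCount : length G ≤ typeCount m k d s
      length≤typeCount = cancel-c (subst₂ _≤_ double-count count-all (∑-mono flags λ {t} _ → multiplicity≤ t))

      Complete : Set
      Complete = ∀ {P} → Typed P → Any (λ Q → Q ≐ P) G

      -- Each adapted flag spans a typed subspace, which completeness places in `G`; hence no flag
      -- is missed.
      complete⇒typeCount≤length : Complete → typeCount m k d s ≤ length G
      complete⇒typeCount≤length complete = cancel-c (subst₂ _≤_ count-all double-count (∑-mono flags λ {t} _ → covered t))
        where
        covered : ∀ t → ⟦ adapted U X t ⟧ ≤ multiplicity t
        covered t with adapted U X t in h
        ... | false = z≤n
        ... | true with find (complete (span-typed t h))
        ...   | Q , Q∈ , e = ≤-trans (⟦⟧-mono {true} λ _ →
                  ∧-intro (all∈-mono (≐⇒⊆ (≐-sym e)) (proj₁ t) (∧-elimˡ (span-contains t h)))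
                          (all∈-mono (≐⇒⊆ (≐-sym e)) (proj₂ t) (∧-elimʳ {all∈ (span t) (proj₁ t)} (span-contains t h))))
                (∑-term (λ P → ⟦ contains P t ⟧) Q∈)

      -- At equality `∑-tight` gives every adapted flag multiplicity one. A flag of `P` then lies in
      -- a member of `G`, and both are its span.
      typeCount≤length⇒complete : typeCount m k d s ≤ length G → Complete
      typeCount≤length⇒complete le {P} T
        with ∑-positive flags _ (subst (1 ≤_) (sym (count-contained T)) c-positive)
      ... | t , t∈ , pos = locate (positive-Any (subst (1 ≤_) (sym mult≡1) ≤-refl))
        where
        both : adapted U X t ∧ contains P t ≡ true
        both = go pos
          where
          go : ∀ {b} → 1 ≤ ⟦ b ⟧ → b ≡ true
          go {true} _ = refl
        h = ∧-elimˡ {adapted U X t} both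
        mult≡1 : multiplicity t ≡ 1
        mult≡1 = trans (∑-tight flags (λ {t} _ → multiplicity≤ t)
          (subst₂ _≤_ (sym count-all) (sym double-count) (*-monoˡ-≤ c le)) t∈) (cong ⟦_⟧ h)
        positive-Any : 1 ≤ multiplicity t → ∃ λ Q → Q ∈ G × 1 ≤ ⟦ adapted U X t ∧ contains Q t ⟧
        positive-Any = ∑-positive G _
        locate : (∃ λ Q → Q ∈ G × 1 ≤ ⟦ adapted U X t ∧ contains Q t ⟧) → Any (λ Q → Q ≐ P) G
        locate (Q , Q∈ , pos′) with contains Q t in hQ
        ... | true = lose Q∈ λ v → trans (sym (span-unique t h (typed Q∈) hQ v)) (span-unique t h T (∧-elimʳ {adapted U X t} both) v)
        ... | false = ⊥-elim (<⇒≱ pos′ (≤-reflexive (cong ⟦_⟧ (Bool.∧-zeroʳ (adapted U X t)))))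

-- The extremal families

module Extremal {q : ℕ} (𝔽 : FiniteField q) (n₀ n l k : ℕ) where
  open VectorSpace 𝔽
  open Dimension 𝔽
  open Gaussian q
  open Dichotomy 𝔽 {n + l} n₀
  open AdaptedBases 𝔽 using (Typed; module Typed; length≤typeCount; complete⇒typeCount≤length; typeCount≤length⇒complete)

  d t : ℕ
  d = 2 * m ∸ 1
  t = tParam m k n

  d≡r+m : d ≡ r + m
  d≡r+m = cong (r +_) (+-identityʳ m)

  module _ {W : Pred (n + l)} (W-subspace : IsSubspace W) (W-dim : HasDim W l)
           {𝓕 : Family (n + l)} (distinct : Distinct 𝓕)
           (types : ∀ {P} → P ∈ 𝓕 → IsOfType W m k P)
           (pairwise : IsIntersecting 𝓕) (covering : CoveringNumber 𝓕 m)
           (q-large : m + 2 ≤ q) where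

    W-card : card W ≡ q ^ l
    W-card = card-HasDim W-subspace W-dim

    subspace : ∀ {P} → P ∈ 𝓕 → IsSubspace P
    subspace P∈ = proj₁ (types P∈)

    dim : ∀ {P} → P ∈ 𝓕 → card P ≡ q ^ m
    dim P∈ = card-HasDim (subspace P∈) (proj₁ (proj₂ (types P∈)))

    dim-∩W : ∀ {P} → P ∈ 𝓕 → card (P ∩ W) ≡ q ^ k
    dim-∩W P∈ = card-HasDim (∩-subspace (subspace P∈) W-subspace) (proj₂ (proj₂ (types P∈)))

    intersecting : ∀ {P Q} → P ∈ 𝓕 → Q ∈ 𝓕 → q ≤ card (P ∩ Q)
    intersecting P∈ Q∈ = Intersect⇒ (subspace P∈) (subspace Q∈) (pairwise P∈ Q∈)

    cover-dim : ∀ {T} → IsSubspace T → ∀ {e} → card T ≡ q ^ e → Covers T 𝓕 → m ≤ e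
    cover-dim s h = proj₂ covering _ _ s (HasDim-card s h)

    avoid : ∀ {A} → IsSubspace A → ∀ {a} → card A ≡ q ^ a → a < m → ∃ λ B → B ∈ 𝓕 × (A ∩ B) ⊆ zeroS
    avoid {A} s h a<m with search∈ 𝓕 (λ P → not (meets A P))
    ... | inj₁ (B , B∈ , e) = B , B∈ , ¬meets⇒∩⊆zeroS A B (not-elim e)
    ... | inj₂ all = ⊥-elim (<⇒≱ a<m (cover-dim s h covers))
      where
      covers : Covers A 𝓕
      covers {P} P∈ with meets A P in e
      ... | false = ⊥-elim (false⇒not-true (all P∈) (cong not e))
      ... | true with meets-elim A P e
      ...   | v , Av , Pv , v≢0 = ⇒Intersect s (subspace P∈) Av Pv v≢0

    -- An (m-1)-dimensional subspace of a smaller U would meet every P ∩ U.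
    cover-bound : ∀ {U} → IsSubspace U → ∀ {u κ} → card U ≡ q ^ u → 1 ≤ κ →
      (∀ {P} → P ∈ 𝓕 → card (P ∩ U) ≡ q ^ κ) → m + κ ≤ suc u
    cover-bound {U} U-subspace {u} {κ} U-card 1≤κ traces with m + κ ≤? suc u
    ... | yes h = h
    -- The dimension chosen is the smaller of `u` and `r`: all of `U` if that is below the covering
    -- number, otherwise one less than it. In both cases adding `κ` exceeds `u`.
    ... | no h with subspace-of-dim U-subspace U-card (m⊓n≤m u r)
    ...   | T , T-subspace , T⊆U , T-card = ⊥-elim (<⇒≱ (s≤s (m⊓n≤n u r)) (cover-dim T-subspace T-card covers))
      where
      large : u < u ⊓ r + κ
      large with u ≤? r
      ... | yes u≤r rewrite m≤n⇒m⊓n≡m u≤r = m<m+n u 1≤κ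
      ... | no u≰r rewrite m≥n⇒m⊓n≡n (<⇒≤ (≰⇒> u≰r)) = s≤s⁻¹ (≰⇒> h)
      covers : Covers T 𝓕
      covers {P} P∈ with nontrivial (Intersect⇒ T-subspace PU-subspace
          (meet-large T-subspace PU-subspace U-subspace T⊆U (∩⊆ʳ P U) {u ⊓ r} {κ} {u} T-card (traces P∈) U-card large))
        where PU-subspace = ∩-subspace (subspace P∈) U-subspace
      ... | v , h , v≢0 = ⇒Intersect T-subspace (subspace P∈) (∧-elimˡ h) (∧-elimˡ (∧-elimʳ {T v} h)) v≢0

    -- A list might be empty; that the zero subspace is no cover rules this out.
    member : ∃ λ P → P ∈ 𝓕
    member with avoid zeroS-subspace {0} (card-zeroS {n + l}) (s≤s z≤n)
    ... | P , P∈ , _ = P , P∈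

    V-card : card {n + l} (λ _ → true) ≡ q ^ (n + l)
    V-card = card-universe {n + l}

    k≤m : k ≤ m
    k≤m with member
    ... | P , P∈ = ^-cancel-≤ (subst₂ _≤_ (dim-∩W P∈) (dim P∈) (card-mono (∩⊆ˡ P W)))

    m≤n+k : m ≤ n + k
    m≤n+k with member
    ... | P , P∈ = +-cancelʳ-≤ l m (n + k) (≤-trans
      (dim-∩ (subspace P∈) W-subspace universe (λ _ _ → refl) (λ _ _ → refl) {m} {l} {n + l} {k} (dim P∈) W-card V-card (dim-∩W P∈))
      (≤-reflexive (solve 3 (λ n l k → n :+ l :+ k := n :+ k :+ l) refl n l k)))
     

    m∸k≤n : m ∸ k ≤ n
    m∸k≤n = m≤n+o⇒m∸n≤o m k (≤-trans m≤n+k (≤-reflexive (+-comm n k)))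

    restrict : ∀ {P X} → P ⊆ X → card (P ∩ (X ∩ W)) ≡ card (P ∩ W)
    restrict {P} {X} f = card-cong (⊆-antisym
      (λ v h → ∧-intro (∧-elimˡ {P v} h) (∧-elimʳ {X v} (∧-elimʳ {P v} h)))
      (λ v h → ∧-intro (∧-elimˡ {P v} h) (∧-intro (f v (∧-elimˡ h)) (∧-elimʳ {P v} h))))

    -- Gathers what is needed about `t`, so that the two cases of its definition are separated only
    -- here. The first five fields, with `k≤m`, select the nonzero branch of `Ncount`; `large` beats
    -- small families; `maximal` compares `t` with the actual dimension `s` of `X ∩ W`.
    record Optimal (k t : ℕ) : Set where
      field
        k≤t     : k ≤ t
        t≤l     : t ≤ l
        t≤d     : t ≤ d
        fits    : m ∸ k ≤ d ∸ t
        fits-n  : d ∸ t ≤ n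
        large   : (q ^ m) ^ r ≤ typeCount m k d t
        k≤s     : ∀ {X s} → IsSubspace X → card X ≡ q ^ d → card (X ∩ W) ≡ q ^ s → (∀ {P} → P ∈ 𝓕 → P ⊆ X) → k ≤ s
        maximal : ∀ {X s} → IsSubspace X → card X ≡ q ^ d → card (X ∩ W) ≡ q ^ s → (∀ {P} → P ∈ 𝓕 → P ⊆ X) →
          s ≡ t ⊎ typeCount m k d s < typeCount m k d t

    optimal : Optimal k t
    optimal = go k refl
      where
      -- Splitting on a copy of `k` lets `tParam` compute in each case.
      go : ∀ k′ → k′ ≡ k → Optimal k′ (tParam m k′ n)
      go zero refl = record
        { k≤t = z≤n
        ; t≤l = m≤n+o⇒m∸n≤o d n d≤n+l
        ; t≤d = m∸n≤m d n
        ; fits = fits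
        ; fits-n = m≤n+o⇒m∸n≤o d (d ∸ n) (≤-trans (m≤n+m∸n d n) (≤-reflexive (+-comm n (d ∸ n))))
        ; large = large
        ; k≤s = λ _ _ _ _ → z≤n
        ; maximal = maximal }
        where
        open ≤-Reasoning
        -- In the whole space every member has trace of dimension `m`, so `cover-bound` gives 2m ≤ n
        -- + l + 1.
        d≤n+l : d ≤ n + l
        d≤n+l = ≤-trans (≤-reflexive d≡r+m) (s≤s⁻¹ (cover-bound universe {n + l} {m} V-card (s≤s z≤n)
          λ {P} P∈ → trans (card-cong (⊆-antisym (∩⊆ˡ P _) λ v h → ∧-intro h refl)) (dim P∈)))
        -- The right side is the smaller of `d` and `n`; `m≤n+k` handles `n`, as `k` is zero.
        fits : m ≤ d ∸ (d ∸ n)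
        fits with n ≤? d
        ... | yes n≤d = ≤-trans (≤-trans m≤n+k (≤-reflexive (+-identityʳ n))) (≤-reflexive (sym (m∸[m∸n]≡n n≤d)))
        ... | no n≰d rewrite m≤n⇒m∸n≡0 (<⇒≤ (≰⇒> n≰d)) = ≤-trans (m≤n+m m r) (≤-reflexive (sym d≡r+m))
        t₀ = d ∸ n
        e = (d ∸ t₀) ∸ m
        e+m : e + m ≡ d ∸ t₀
        e+m = m∸n+n≡m fits
        -- Hence the exponents `m * t₀` and `m * e` add up to `m * r` in `large`.
        t+e : t₀ + e ≡ r
        t+e = +-cancelʳ-≡ m (t₀ + e) r (begin-equality
          t₀ + e + m       ≡⟨ +-assoc t₀ e m ⟩
          t₀ + (e + m)     ≡⟨ cong (t₀ +_) e+m ⟩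
          t₀ + (d ∸ t₀)    ≡⟨ m+[n∸m]≡n (m∸n≤m d n) ⟩
          d                ≡⟨ d≡r+m ⟩
          r + m ∎)
        large : (q ^ m) ^ r ≤ typeCount m 0 d t₀
        large = begin
          (q ^ m) ^ r                             ≡⟨ ^-*-assoc q m r ⟩
          q ^ (m * r)                             ≡⟨ cong (λ z → q ^ (m * z)) (sym t+e) ⟩
          q ^ (m * (t₀ + e))                      ≡⟨ trans (cong (q ^_) (*-distribˡ-+ m t₀ e)) (^-distribˡ-+-* q (m * t₀) (m * e)) ⟩
          q ^ (m * t₀) * q ^ (m * e)              ≤⟨ *-monoʳ-≤ (q ^ (m * t₀)) (gauss-lower m e) ⟩
          q ^ (m * t₀) * gauss q (e + m) m        ≡⟨ cong (λ z → q ^ (m * t₀) * gauss q z m) e+m ⟩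
          q ^ (m * t₀) * gauss q (d ∸ t₀) m       ≡⟨ sym (*-identityʳ _) ⟩
          typeCount m 0 d t₀ ∎
        maximal : ∀ {X s} → IsSubspace X → card X ≡ q ^ d → card (X ∩ W) ≡ q ^ s → (∀ {P} → P ∈ 𝓕 → P ⊆ X) →
          s ≡ t₀ ⊎ typeCount m 0 d s < typeCount m 0 d t₀
        maximal {X} {s} X-subspace X-card XW-card _ = descend (m≤n⇒m<n∨m≡n t₀≤s)
          where
          t₀≤s : t₀ ≤ s
          t₀≤s = m≤n+o⇒m∸n≤o d n (+-cancelʳ-≤ l d (n + s) (≤-trans
            (dim-∩ X-subspace W-subspace universe (λ _ _ → refl) (λ _ _ → refl) {d} {l} {n + l} {s} X-card W-card V-card XW-card)
            (≤-reflexive (trans (+-assoc n l s) (trans (cong (n +_) (+-comm l s)) (sym (+-assoc n s l)))))))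
          s≤d : s ≤ d
          s≤d = ^-cancel-≤ (subst₂ _≤_ XW-card X-card (card-mono (∩⊆ˡ X W)))
          descend : t₀ < s ⊎ t₀ ≡ s → s ≡ t₀ ⊎ typeCount m 0 d s < typeCount m 0 d t₀
          descend (inj₂ e) = inj₁ (sym e)
          -- Of the unit shifts from `s` down to `t₀`, all but the last are estimated weakly; the
          -- last is strict because `m ≤ d ∸ t₀`.
          descend (inj₁ t₀<s) = inj₂ (subst₂ _<_ (sym (*-identityʳ _)) (sym (*-identityʳ _)) (begin-strict
            q ^ (m * s) * gauss q a m                  ≡⟨ cong (λ z → q ^ (m * z) * gauss q a m) (sym (m∸n+n≡m t₀<s)) ⟩
            q ^ (m * (g + suc t₀)) * gauss q a m       ≤⟨ gauss-shift-≤ r (suc t₀) g a ⟩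
            q ^ (m * suc t₀) * gauss q (g + a) m       <⟨ gauss-shift-< r t₀ (g + a) (s≤s⁻¹ (≤-trans fits (≤-reflexive (sym g+a)))) ⟩
            q ^ (m * t₀) * gauss q (suc (g + a)) m     ≡⟨ cong (λ z → q ^ (m * t₀) * gauss q z m) g+a ⟩
            q ^ (m * t₀) * gauss q (d ∸ t₀) m ∎))
            where
            a g : ℕ
            a = d ∸ s
            g = s ∸ suc t₀
            g+a : suc (g + a) ≡ d ∸ t₀
            g+a = +-cancelˡ-≡ t₀ _ _ (begin-equality
              t₀ + suc (g + a)      ≡⟨ solve 3 (λ t g a → t :+ (con 1 :+ (g :+ a)) := g :+ (con 1 :+ t) :+ a) refl t₀ g a ⟩
              g + suc t₀ + a        ≡⟨ cong (_+ a) (m∸n+n≡m t₀<s) ⟩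
              s + a                 ≡⟨ m+[n∸m]≡n s≤d ⟩
              d                     ≡⟨ sym (m+[n∸m]≡n (m∸n≤m d n)) ⟩
              t₀ + (d ∸ t₀) ∎)
             
      go (suc k₀) refl = record
        { k≤t = m≤n+m k r
        ; t≤l = s≤s⁻¹ (cover-bound W-subspace W-card (s≤s z≤n) dim-∩W)
        ; t≤d = ≤-trans (+-monoʳ-≤ r k≤m) (≤-reflexive (sym d≡r+m))
        ; fits = ≤-reflexive (sym d∸t)
        ; fits-n = ≤-trans (≤-reflexive d∸t) m∸k≤n
        ; large = large
        ; k≤s = λ X-subspace X-card XW-card f → ≤-trans (m≤n+m k r) (≤-reflexive (sym (s≡t X-subspace X-card XW-card f)))
        ; maximal = λ X-subspace X-card XW-card f → inj₁ (s≡t X-subspace X-card XW-card f) }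
        where
        open ≤-Reasoning
        d∸t : d ∸ (r + k) ≡ m ∸ k
        d∸t = trans (cong (_∸ (r + k)) d≡r+m) ([m+n]∸[m+o]≡n∸o r m k)
        j = m ∸ k
        large : (q ^ m) ^ r ≤ typeCount m k d (r + k)
        large = begin
          (q ^ m) ^ r                              ≡⟨ ^-*-assoc q m r ⟩
          q ^ (m * r)                              ≡⟨ cong (λ z → q ^ (z * r)) (sym (m∸n+n≡m k≤m)) ⟩
          q ^ ((j + k) * r)                        ≡⟨ trans (cong (q ^_) (*-distribʳ-+ r j k)) (^-distribˡ-+-* q (j * r) (k * r)) ⟩
          q ^ (j * r) * q ^ (k * r)                ≤⟨ *-monoʳ-≤ (q ^ (j * r)) (gauss-lower k r) ⟩
          q ^ (j * r) * gauss q (r + k) k          ≡⟨ cong (λ z → q ^ (j * z) * gauss q (r + k) k) (sym (m+n∸n≡m r k)) ⟩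
          q ^ (j * (r + k ∸ k)) * gauss q (r + k) k
            ≤⟨ *-monoˡ-≤ (gauss q (r + k) k) (m≤m*n (q ^ (j * (r + k ∸ k))) (gauss q (d ∸ (r + k)) j)
                 {{>-nonZero (gauss-positive (≤-reflexive (sym d∸t)))}}) ⟩
          typeCount m k d (r + k) ∎
        -- The lower bound comes from the covering number, through `cover-bound` in `X ∩ W`; the
        -- upper one from a member and `X ∩ W` inside `X`.
        s≡t : ∀ {X s} → IsSubspace X → card X ≡ q ^ d → card (X ∩ W) ≡ q ^ s → (∀ {P} → P ∈ 𝓕 → P ⊆ X) → s ≡ r + k
        s≡t {X} {s} X-subspace X-card XW-card f = ≤-antisym upper
          (s≤s⁻¹ (cover-bound U-subspace XW-card (s≤s z≤n) traces))
          where
          U-subspace = ∩-subspace X-subspace W-subspace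
          traces : ∀ {P} → P ∈ 𝓕 → card (P ∩ (X ∩ W)) ≡ q ^ k
          traces P∈ = trans (restrict (f P∈)) (dim-∩W P∈)
          upper : s ≤ r + k
          upper with member
          ... | P , P∈ = +-cancelˡ-≤ m s (r + k) (≤-trans
            (dim-∩ (subspace P∈) U-subspace X-subspace (f P∈) (∩⊆ˡ X W) {m} {s} {d} {k} (dim P∈) XW-card X-card (traces P∈))
            (≤-reflexive (trans (cong (_+ k) (trans d≡r+m (+-comm r m))) (+-assoc m r k))))

    open Optimal optimal

    bound : ℕ
    bound = Ncount q m k d t n l

    bound≡typeCount : bound ≡ typeCount m k d t
    bound≡typeCount = Ncount≡ k≤t t≤l k≤m t≤d fits fits-n

    -- `twice-power` replaces `2 * q ^ r` by the larger `p ^ m`, which then cancels; `large` does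
    -- the rest.
    small⇒< : SmallFamily 𝓕 subspace distinct dim intersecting avoid → length 𝓕 < bound
    small⇒< h = ≤-trans (*-cancelˡ-< (p ^ m) (length 𝓕) ((q ^ m) ^ r) (begin-strict
      p ^ m * length 𝓕              ≤⟨ h ⟩
      2 * (q ^ r * (q ^ m) ^ r)     ≡⟨ sym (*-assoc 2 (q ^ r) _) ⟩
      2 * q ^ r * (q ^ m) ^ r       <⟨ *-monoˡ-< ((q ^ m) ^ r) {{m^n≢0 (q ^ m) r {{m^n≢0 q m}}}} (twice-power r q (s≤s z≤n) q-large) ⟩
      p ^ m * (q ^ m) ^ r ∎)) (≤-trans large (≤-reflexive (sym bound≡typeCount)))
      where open ≤-Reasoning

    -- The dimension `s` is left free, because the count inside `X` is needed before `s` is known to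
    -- be `t`.
    module Inside {X : Pred (n + l)} (X-subspace : IsSubspace X) (X-card : card X ≡ q ^ d)
                  {s : ℕ} (XW-card : card (X ∩ W) ≡ q ^ s) (inside : ∀ {P} → P ∈ 𝓕 → P ⊆ X) where

      U-subspace = ∩-subspace X-subspace W-subspace

      k≤s′ : k ≤ s
      k≤s′ = k≤s {X} {s} X-subspace X-card XW-card inside

      TypedIn : Pred (n + l) → Set
      TypedIn = Typed X-subspace U-subspace (∩⊆ˡ X W) {d} {s} X-card XW-card {m} {k} k≤m k≤s′

      typed : ∀ {P} → IsSubspace P → card P ≡ q ^ m → card (P ∩ W) ≡ q ^ k → P ⊆ X → TypedIn P
      typed s e e′ f = record { subspace = s ; dim = e ; dim-∩U = trans (restrict f) e′ ; ⊆X = f }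

      typed⇒IsOfType : ∀ {P} → TypedIn P → IsOfType W m k P
      typed⇒IsOfType T = subspace′ , HasDim-card subspace′ dim′
        , HasDim-card (∩-subspace subspace′ W-subspace) (trans (sym (restrict ⊆X′)) dim-∩U′)
        where
        open Typed T renaming (subspace to subspace′; dim to dim′; dim-∩U to dim-∩U′; ⊆X to ⊆X′)

      members : ∀ {P} → P ∈ 𝓕 → TypedIn P
      members P∈ = typed (subspace P∈) (dim P∈) (dim-∩W P∈) (inside P∈)

      upper : length 𝓕 ≤ typeCount m k d s
      upper = length≤typeCount X-subspace U-subspace (∩⊆ˡ X W) {d} {s} X-card XW-card {m} {k} k≤m k≤s′ 𝓕 members distinct

      full⇒lower : (∀ {P} → TypedIn P → Any (λ Q → Q ≐ P) 𝓕) → typeCount m k d s ≤ length 𝓕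
      full⇒lower = complete⇒typeCount≤length X-subspace U-subspace (∩⊆ˡ X W) {d} {s} X-card XW-card {m} {k} k≤m k≤s′ 𝓕 members distinct

      lower⇒full : typeCount m k d s ≤ length 𝓕 → ∀ {P} → TypedIn P → Any (λ Q → Q ≐ P) 𝓕
      lower⇒full = typeCount≤length⇒complete X-subspace U-subspace (∩⊆ˡ X W) {d} {s} X-card XW-card {m} {k} k≤m k≤s′ 𝓕 members distinct

      upper-bound : length 𝓕 ≤ bound
      upper-bound with maximal {X} {s} X-subspace X-card XW-card inside
      ... | inj₁ e = ≤-trans upper (≤-reflexive (trans (cong (typeCount m k d) e) (sym bound≡typeCount)))
      ... | inj₂ lt = ≤-trans upper (≤-trans (<⇒≤ lt) (≤-reflexive (sym bound≡typeCount)))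

      -- For any other `s`, `maximal` puts the count inside `X` strictly below `bound`.
      tight : bound ≤ length 𝓕 → s ≡ t
      tight le with maximal {X} {s} X-subspace X-card XW-card inside
      ... | inj₁ e = e
      ... | inj₂ lt = ⊥-elim (<⇒≱ lt (≤-trans (≤-reflexive (sym bound≡typeCount)) (≤-trans {bound} le upper)))

      transport : ∀ {P} → Any (λ Q → Q ≐ P) 𝓕 → IsOfType W m k P × (P ⊆ X)
      transport {P} a with find a
      ... | Q , Q∈ , e = (P-subspace , HasDim-card P-subspace (trans (card-cong (≐-sym e)) (dim Q∈))
          , HasDim-card (∩-subspace P-subspace W-subspace) (trans (card-cong λ v → cong (_∧ W v) (sym (e v))) (dim-∩W Q∈)))
          , ⊆-trans (≐⇒⊆ (≐-sym e)) (inside Q∈)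
        where P-subspace = subspace-cong e (subspace Q∈)

    Characterised : Pred (n + l) → Set
    Characterised X = IsOfType W d t X
      × (∀ P → IsSubspace P → (Any (λ Q → Q ≐ P) 𝓕 ⇔ (IsOfType W m k P × (P ⊆ X))))

    cases : length 𝓕 < bound ⊎ Contained 𝓕 subspace distinct dim intersecting avoid
    cases with dichotomy 𝓕 subspace distinct dim intersecting avoid
    ... | inj₁ h = inj₁ (small⇒< h)
    ... | inj₂ h = inj₂ h

    length≤bound : length 𝓕 ≤ bound
    length≤bound with cases
    ... | inj₁ h = <⇒≤ h
    ... | inj₂ (X , X-subspace , X-card , inside) =
      Inside.upper-bound X-subspace (trans X-card (cong (q ^_) (sym d≡r+m)))
        {proj₁ (card-power (∩-subspace X-subspace W-subspace))} (proj₂ (card-power (∩-subspace X-subspace W-subspace))) inside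

    -- Equality excludes the small case, and `tight` gives `X` the right type. The count in `X` is
    -- then attained, so every subspace of type (m, k) in `X` is a member.
    equality⇒ : length 𝓕 ≡ bound → Σ (Pred (n + l)) Characterised
    equality⇒ e with cases
    ... | inj₁ h = ⊥-elim (<⇒≢ h e)
    ... | inj₂ (X , X-subspace , X-card′ , inside) = X , (X-subspace , HasDim-card X-subspace X-card
        , HasDim-card U-subspace XW-card)
        , λ P s → mk⇔ I.transport λ { ((_ , h , h′) , f) → I.lower⇒full (≤-reflexive (trans (sym bound≡typeCount) (sym e)))
            (I.typed s (card-HasDim s h) (card-HasDim (∩-subspace s W-subspace) h′) f) }
      where
      U-subspace = ∩-subspace X-subspace W-subspace
      X-card : card X ≡ q ^ d
      X-card = trans X-card′ (cong (q ^_) (sym d≡r+m))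
      XW-card : card (X ∩ W) ≡ q ^ t
      XW-card = trans (proj₂ (card-power U-subspace)) (cong (q ^_)
        (Inside.tight X-subspace X-card {proj₁ (card-power U-subspace)} (proj₂ (card-power U-subspace)) inside (≤-reflexive (sym e))))
      module I = Inside X-subspace X-card {t} XW-card inside

    -- The characterisation puts all members in `X` and makes the family complete there, so the
    -- count in `X` is a lower bound.
    equality⇐ : Σ (Pred (n + l)) Characterised → length 𝓕 ≡ bound
    equality⇐ (X , (X-subspace , X-dim , XW-dim) , iff) = ≤-antisym length≤bound
      (≤-trans (≤-reflexive bound≡typeCount) (I.full⇒lower λ {P} T →
        Equivalence.from (iff P (Typed.subspace T)) (I.typed⇒IsOfType T , Typed.⊆X T)))
      where
      inside : ∀ {P} → P ∈ 𝓕 → P ⊆ X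
      inside {P} P∈ = proj₂ (Equivalence.to (iff P (subspace P∈)) (lose P∈ λ _ → refl))
      module I = Inside X-subspace (card-HasDim X-subspace X-dim)
        {t} (card-HasDim (∩-subspace X-subspace W-subspace) XW-dim) inside

theorem3p1 : (q m : ℕ) (𝔽 : FiniteField q) → let open LinAlg 𝔽 in
    m + 2 ≤ q → 5 ≤ m + 2 →
    (n l k : ℕ) → 1 ≤ n →
    (W₁ : Pred (n + l)) → IsSubspace W₁ → HasDim W₁ l →
    (𝓕 : Family (n + l)) → Distinct 𝓕 →
    (∀ {P} → P ∈ 𝓕 → IsOfType W₁ m k P) →
    IsIntersecting 𝓕 → CoveringNumber 𝓕 m →
    (length 𝓕 ≤ Ncount q m k (2 * m ∸ 1) (tParam m k n) n l)
    × ((length 𝓕 ≡ Ncount q m k (2 * m ∸ 1) (tParam m k n) n l)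
       ⇔ Σ (Pred (n + l)) λ X → IsOfType W₁ (2 * m ∸ 1) (tParam m k n) X
           × (∀ P → IsSubspace P →
                ((Any (λ Q → Q ≐ P) 𝓕) ⇔ (IsOfType W₁ m k P × (P ⊆ X)))))
-- The values 0 and 1 contradict `5 ≤ m + 2`, so `m` has the form `suc (suc n₀)` that `Extremal`
-- works with.
theorem3p1 q zero 𝔽 _ (s≤s (s≤s ()))
theorem3p1 q (suc zero) 𝔽 _ (s≤s (s≤s (s≤s ())))
theorem3p1 q (suc (suc n₀)) 𝔽 q-large _ n l k _ W W-subspace W-dim 𝓕 distinct types pairwise covering =
  length≤bound W-subspace W-dim distinct types pairwise covering q-large
  , mk⇔ (equality⇒ W-subspace W-dim distinct types pairwise covering q-large)
        (equality⇐ W-subspace W-dim distinct types pairwise covering q-large)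
  where open Extremal 𝔽 n₀ n l k
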